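{- Let $N\geq 2$ be an integer and $x\in[0,1]\setminus\mathbb{Q}$. The factor complexity functions of $\omega=\omega(x,N)$ and $\widehat\omega=\widehat\omega(x,N)$ satisfy $p_\omega(n)\le 2n$ and $p_{\widehat\omega}(n)\le 2n$ for all $n\ge1$. In particular, they are given by $$p_\omega(n)=\begin{cases}1,& n=0,\\ 2n,& 1\le n\le N-1,\\ n+1+\sum_{j=-1}^{k-1}(p_j+q_j)(N-1),& t_k<n\le s_{k+1},\\ 2n+1+\sum_{j=-1}^{k-1}(p_j+q_j)(N-1)-s_k,& s_k<n\le t_k,\end{cases}$$ and $$p_{\widehat\omega}(n)=\begin{cases}1,& n=0,\\ n+1+\sum_{j=0}^{k-2}\left(\frac{p_j}{N}+q_j\right)(N-1),& \widehat t_{k-1}<n\le\widehat s_k,\\ 2n+1+\sum_{j=0}^{k-2}\left(\frac{p_j}{N}+q_j\right)(N-1)-\widehat s_k,& \widehat s_k<n\le\widehat t_k.\end{cases}$$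
   Context: Let $N\ge 2$ be an integer and define $T_N:[0,1]\to[0,1]$ by $T_N(x)=\frac{N}{x}-\lfloor\frac{N}{x}\rfloor$ for $x\ne0$ and $T_N(0)=0$. For $x\in[0,1]\setminus\mathbb{Q}$ the (greedy) NCF digits of $x$ are $d_n=\lfloor N/T_N^{n-1}(x)\rfloor\ge N$, $n\ge1$; one writes $x=[0;d_1,d_2,\ldots]_N$. A substitution on $\{0,1\}$ is given by images of the letters (nonempty words) and extends to finite and infinite words by concatenation. For $x=[0;d_1,d_2,\ldots]_N$ irrational let $\sigma_n(0)=0^{d_n}1^N$, $\sigma_n(1)=0$ and $\widehat\sigma_n(0)=0^{d_n}1$, $\widehat\sigma_n(1)=0^N$ for $n\ge1$. The NCF sequence $\omega(x,N)\in\{0,1\}^{\mathbb N}$ is the unique infinite word $\omega$ for which there exist $\omega^{(1)},\omega^{(2)},\ldots\in\{0,1\}^{\mathbb{N}}$ with $\omega^{(1)}=\omega$ and $\omega^{(n)}=\sigma_n(\omega^{(n+1)})$ for all $n\ge1$. The dual NCF sequence $\widehat\omega(x,N)$ is defined in the same way with $\widehat\sigma_n$ in place of $\sigma_n$. The factor complexity $p_\nu(n)$ of a sequence $\nu$ is the number of distinct factors (contiguous subwords) of $\nu$ of length $n$. Define $p_{ -1}=1$, $p_0=0$, $q_{ -1}=0$, $q_0=1$ and $p_n=d_np_{n-1}+Np_{n-2}$, $q_n=d_nq_{n-1}+Nq_{n-2}$ for $n\ge1$. Define words $\Sigma_n=\sigma_1\circ\cdots\circ\sigma_n(1)$ for $n\ge1$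 (so $\Sigma_1=0$), and $\widehat\Sigma_1=0$, $\widehat\Sigma_{n+1}=\widehat\sigma_1\circ\cdots\circ\widehat\sigma_n(0)$ for $n\geq 1$. For $k\ge1$ put $S_k=\Sigma_k^{d_k}\Sigma_{k-1}^{d_{k-1}}\cdots\Sigma_1^{d_1}$, $T_k=\Sigma_k^{N-1}S_k$, and $\widehat S_k=\widehat\Sigma_k^{d_k}\widehat\Sigma_{k-1}^{d_{k-1}}\cdots\widehat\Sigma_1^{d_1}$, $\widehat T_k=\widehat\Sigma_k^{N-1}\widehat S_k$; also put $T_0=1^{N-1}$. With $|\cdot|$ denoting word length, put $s_k=|S_k|$ ($k\ge1$), $t_k=|T_k|$ ($k\ge0$), $\widehat s_k=|\widehat S_k|$ ($k\ge1$), $\widehat t_0=0$, $\widehat t_k=|\widehat T_k|$ ($k\ge1$). Then $t_0<s_1<t_1<s_2<\cdots$ and $\widehat t_0<\widehat s_1<\widehat t_1<\widehat s_2<\cdots$. Empty sums are $0$.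
   Formalization: The last case of each formula is false as printed and is corrected: for s_k<n≤t_k it reads 2n+Σ_{j=-1}^{k-2}(p_j+q_j)(N-1)-s_k, and for ŝ_k<n≤t̂_k it reads 2n+Σ_{j=0}^{k-2}(p_j/N+q_j)(N-1)-ŝ_k. -}

module Defs where

open import Data.Fin.Base using (Fin; zero; suc)
import Data.Integer.Base as ℤ
open import Data.List.Base using (List; []; _∷_; [_]; _++_; length; replicate; concat; concatMap; applyUpTo)
open import Data.List.NonEmpty.Base as List⁺ using (List⁺; _∷_; _++⁺_; toList)
open import Data.List.Membership.Propositional using (_∈_)
open import Data.List.Relation.Unary.Unique.Propositional using (Unique)
open import Data.Nat.ListAction using (sum)
open import Data.Nat.Base using (ℕ; zero; suc; _+_; _*_; _∸_; _≤_; _/_; NonZero; ≢-nonZero⁻¹)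
open import Data.Nat.Divisibility using (_∣_; ∣m∣n⇒∣m+n; ∣n⇒∣m*n; m∣m*n; _∣0)
open import Data.Product.Base using (Σ-syntax; ∃-syntax; _×_; _,_; proj₁; proj₂)
open import Data.Rational.Base as ℚ using (ℚ; 0ℚ; 1ℚ)
import Data.Rational.Properties as ℚ
open import Data.Sum.Base using (_⊎_; inj₁; inj₂)
open import Function.Bundles using (_⇔_)
open import Relation.Binary.Definitions using (tri<; tri≈; tri>)
open import Relation.Binary.PropositionalEquality.Core using (_≡_; refl; sym; trans; cong; subst; subst₂)
open import Relation.Nullary using (¬_; yes; no)

record ℝ : Set₁ where
  field
    lower upper : ℚ → Set
    lower-inhabited : ∃[ q ] lower q
    upper-inhabited : ∃[ q ] upper q
    lower-closed    : ∀ {p q} → p ℚ.< q → lower q → lower p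
    upper-closed    : ∀ {p q} → p ℚ.< q → upper p → upper q
    lower-open      : ∀ {p} → lower p → ∃[ q ] p ℚ.< q × lower q
    upper-open      : ∀ {q} → upper q → ∃[ p ] p ℚ.< q × upper p
    disjoint        : ∀ {q} → lower q → ¬ upper q
    located         : ∀ {p q} → p ℚ.< q → lower p ⊎ upper q

open ℝ

infix 4 _≃_

_≃_ : ℝ → ℝ → Set
x ≃ y = ∀ q → (lower x q ⇔ lower y q) × (upper x q ⇔ upper y q)

fromℚ : ℚ → ℝ
fromℚ r = record
  { lower           = ℚ._< r
  ; upper           = r ℚ.<_
  ; lower-inhabited = r ℚ.- 1ℚ , subst (r ℚ.- 1ℚ ℚ.<_) (ℚ.+-identityʳ r) (ℚ.+-monoʳ-< r (ℚ.negative⁻¹ (ℚ.- 1ℚ)))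
  ; upper-inhabited = r ℚ.+ 1ℚ , subst (ℚ._< r ℚ.+ 1ℚ) (ℚ.+-identityʳ r) (ℚ.+-monoʳ-< r (ℚ.positive⁻¹ 1ℚ))
  ; lower-closed    = ℚ.<-trans
  ; upper-closed    = λ p<q r<p → ℚ.<-trans r<p p<q
  ; lower-open      = λ p<r → let m , p<m , m<r = ℚ.<-dense p<r in m , p<m , m<r
  ; upper-open      = λ r<q → let m , r<m , m<q = ℚ.<-dense r<q in m , m<q , r<m
  ; disjoint        = ℚ.<-asym
  ; located         = located′
  }
  where
  located′ : ∀ {p q} → p ℚ.< q → p ℚ.< r ⊎ r ℚ.< q
  located′ {p} p<q with p ℚ.<? r
  ... | yes p<r = inj₁ p<r
  ... | no  p≮r = inj₂ (ℚ.≤-<-trans (ℚ.≮⇒≥ p≮r) p<q)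

Irrational : ℝ → Set
Irrational x = ∀ q → ¬ (x ≃ fromℚ q)

infix 4 _∈[0,1]

_∈[0,1] : ℝ → Set
x ∈[0,1] = ¬ upper x 0ℚ × ¬ lower x 1ℚ

Pos : ℝ → Set
Pos x = lower x 0ℚ

ι : ℕ → ℚ
ι n = ℤ.+ n ℚ./ 1

infixl 6 _−_

_−_ : ℝ → ℚ → ℝ
x − r = record
  { lower           = λ q → lower x (q ℚ.+ r)
  ; upper           = λ q → upper x (q ℚ.+ r)
  ; lower-inhabited = let q , h = lower-inhabited x in q ℚ.- r , subst (lower x) (sym (cancel q)) h
  ; upper-inhabited = let q , h = upper-inhabited x in q ℚ.- r , subst (upper x) (sym (cancel q)) h
  ; lower-closed    = λ p<q → lower-closed x (ℚ.+-monoˡ-< r p<q)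
  ; upper-closed    = λ p<q → upper-closed x (ℚ.+-monoˡ-< r p<q)
  ; lower-open      = λ {p} h → let q , p+r<q , h′ = lower-open x h in
      q ℚ.- r , subst (ℚ._< q ℚ.- r) (cancel′ p) (ℚ.+-monoˡ-< (ℚ.- r) p+r<q)
              , subst (lower x) (sym (cancel q)) h′
  ; upper-open      = λ {q} h → let p , p<q+r , h′ = upper-open x h in
      p ℚ.- r , subst (p ℚ.- r ℚ.<_) (cancel′ q) (ℚ.+-monoˡ-< (ℚ.- r) p<q+r)
              , subst (upper x) (sym (cancel p)) h′
  ; disjoint        = disjoint x
  ; located         = λ p<q → located x (ℚ.+-monoˡ-< r p<q)
  }
  where
  cancel : ∀ q → q ℚ.- r ℚ.+ r ≡ q
  cancel q = trans (ℚ.+-assoc q (ℚ.- r) r)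
            (trans (cong (q ℚ.+_) (ℚ.+-inverseˡ r)) (ℚ.+-identityʳ q))
  cancel′ : ∀ q → q ℚ.+ r ℚ.- r ≡ q
  cancel′ q = trans (ℚ.+-assoc q r (ℚ.- r))
             (trans (cong (q ℚ.+_) (ℚ.+-inverseʳ r)) (ℚ.+-identityʳ q))

private
  quot : (a r : ℚ) → 0ℚ ℚ.< r → ∃[ b ] b ℚ.* r ≡ a
  quot a r 0<r = (a ℚ.* (ℚ.1/ r)) , trans (ℚ.*-assoc a (ℚ.1/ r) r)
      (trans (cong (a ℚ.*_) (ℚ.*-inverseˡ r)) (ℚ.*-identityʳ a))
    where instance _ = ℚ.pos⇒nonZero r {{ℚ.positive 0<r}}

  mul-< : ∀ {p q} r → 0ℚ ℚ.< r → p ℚ.< q → p ℚ.* r ℚ.< q ℚ.* r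
  mul-< r 0<r = ℚ.*-monoˡ-<-pos r {{ℚ.positive 0<r}}

  div-< : ∀ {p q} r → 0ℚ ℚ.< r → p ℚ.* r ℚ.< q ℚ.* r → p ℚ.< q
  div-< r 0<r = ℚ.*-cancelʳ-<-nonNeg r {{ℚ.pos⇒nonNeg r {{ℚ.positive 0<r}}}}

  lower<upper : ∀ x {p q} → lower x p → upper x q → p ℚ.< q
  lower<upper x {p} {q} l u with ℚ.<-cmp p q
  ... | tri< p<q _ _    = p<q
  ... | tri≈ _ refl _   with () ← disjoint x l u
  ... | tri> _ _ q<p    with () ← disjoint x (lower-closed x q<p l) u

  0<ι : ∀ N .{{_ : NonZero N}} → 0ℚ ℚ.< ι N
  0<ι N = ℚ.positive⁻¹ (ι N) {{ℚ.normalize-pos N 1}}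

-- For x > 0:  q < N/x  iff  q r < N for some rational r > x,  and
--             N/x < q  iff  N < q r for some rational 0 < r < x.

module Quotient (a : ℚ) (0<a : 0ℚ ℚ.< a) (x : ℝ) (0<x : Pos x) where

  Lo Up : ℚ → Set
  Lo q = ∃[ r ] upper x r × q ℚ.* r ℚ.< a
  Up q = ∃[ r ] 0ℚ ℚ.< r × lower x r × a ℚ.< q ℚ.* r

  private
    ≤0⇒Lo : ∀ {q} → q ℚ.≤ 0ℚ → Lo q
    ≤0⇒Lo {q} q≤0 with upper-inhabited x
    ... | r , u = r , u , ℚ.≤-<-trans
          (subst (q ℚ.* r ℚ.≤_) (ℚ.*-zeroˡ r)
            (ℚ.*-monoʳ-≤-nonNeg r {{ℚ.pos⇒nonNeg r {{ℚ.positive (lower<upper x 0<x u)}}}} q≤0))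
          0<a

    Up-inhabited : ∃[ q ] Up q
    Up-inhabited with lower-open x 0<x
    ... | r , 0<r , l with quot (a ℚ.+ 1ℚ) r 0<r
    ... | b , br≡ = b , r , 0<r , l , subst (a ℚ.<_) (sym br≡) a<a+1
      where
      a<a+1 : a ℚ.< a ℚ.+ 1ℚ
      a<a+1 = subst (ℚ._< a ℚ.+ 1ℚ) (ℚ.+-identityʳ a) (ℚ.+-monoʳ-< a (ℚ.positive⁻¹ 1ℚ))

    Lo-closed : ∀ {p q} → p ℚ.< q → Lo q → Lo p
    Lo-closed {p} {q} p<q (r , u , qr<a) = r , u , ℚ.<-trans (mul-< {p} {q} r (lower<upper x 0<x u) p<q) qr<a

    Up-closed : ∀ {p q} → p ℚ.< q → Up p → Up q
    Up-closed {p} {q} p<q (r , 0<r , l , a<pr) = r , 0<r , l , ℚ.<-trans a<pr (mul-< {p} {q} r 0<r p<q)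

    Lo-open : ∀ {p} → Lo p → ∃[ q ] p ℚ.< q × Lo q
    Lo-open {p} (r , u , pr<a) with lower<upper x 0<x u
    ... | 0<r with quot a r 0<r
    ... | b , br≡a with ℚ.<-dense (div-< {p} {b} r 0<r (subst (p ℚ.* r ℚ.<_) (sym br≡a) pr<a))
    ... | m , p<m , m<b = m , p<m , r , u , subst (m ℚ.* r ℚ.<_) br≡a (mul-< {m} {b} r 0<r m<b)

    Up-open : ∀ {q} → Up q → ∃[ p ] p ℚ.< q × Up p
    Up-open {q} (r , 0<r , l , a<qr) with quot a r 0<r
    ... | b , br≡a with ℚ.<-dense (div-< {b} {q} r 0<r (subst (ℚ._< q ℚ.* r) (sym br≡a) a<qr))
    ... | m , b<m , m<q = m , m<q , r , 0<r , l , subst (ℚ._< m ℚ.* r) br≡a (mul-< {b} {m} r 0<r b<m)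

    Lo-Up-disjoint : ∀ {q} → Lo q → ¬ Up q
    Lo-Up-disjoint {q} (r , u , qr<a) (r′ , 0<r′ , l , a<qr′) = ℚ.<-asym (ℚ.<-trans a<qr′ qr′<qr) qr<a
      where
      0<q : 0ℚ ℚ.< q
      0<q = div-< {0ℚ} {q} r′ 0<r′ (subst (ℚ._< q ℚ.* r′) (sym (ℚ.*-zeroˡ r′)) (ℚ.<-trans 0<a a<qr′))
      qr′<qr : q ℚ.* r′ ℚ.< q ℚ.* r
      qr′<qr = ℚ.*-monoʳ-<-pos q {{ℚ.positive 0<q}} (lower<upper x l u)

    Lo-Up-located-pos : ∀ {p q} → 0ℚ ℚ.< p → p ℚ.< q → Lo p ⊎ Up q
    Lo-Up-located-pos {p} {q} 0<p p<q with ℚ.<-trans 0<p p<q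
    ... | 0<q with quot a q 0<q | quot a p 0<p
    ... | b , bq≡a | c , cp≡a = answer
      where
      0<b : 0ℚ ℚ.< b
      0<b = div-< {0ℚ} {b} q 0<q (subst₂ ℚ._<_ (sym (ℚ.*-zeroˡ q)) (sym bq≡a) 0<a)
      b<c : b ℚ.< c
      b<c = div-< {b} {c} p 0<p (subst (b ℚ.* p ℚ.<_) (trans bq≡a (sym cp≡a))
              (ℚ.*-monoʳ-<-pos b {{ℚ.positive 0<b}} p<q))
      answer : Lo p ⊎ Up q
      answer with ℚ.<-dense b<c
      ... | r , b<r , r<c with ℚ.<-dense r<c
      ... | r′ , r<r′ , r′<c with located x r<r′
      ... | inj₁ l = inj₂ (r , ℚ.<-trans 0<b b<r , l
                        , subst₂ ℚ._<_ bq≡a (ℚ.*-comm r q) (mul-< {b} {r} q 0<q b<r))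
      ... | inj₂ u = inj₁ (r′ , u
                        , subst₂ ℚ._<_ (ℚ.*-comm r′ p) cp≡a (mul-< {r′} {c} p 0<p r′<c))

    Lo-Up-located : ∀ {p q} → p ℚ.< q → Lo p ⊎ Up q
    Lo-Up-located {p} p<q with 0ℚ ℚ.<? p
    ... | no  0≮p = inj₁ (≤0⇒Lo (ℚ.≮⇒≥ 0≮p))
    ... | yes 0<p = Lo-Up-located-pos 0<p p<q

  quotient : ℝ
  quotient = record
    { lower           = Lo
    ; upper           = Up
    ; lower-inhabited = 0ℚ , ≤0⇒Lo ℚ.≤-refl
    ; upper-inhabited = Up-inhabited
    ; lower-closed    = λ {p} {q} → Lo-closed {p} {q}
    ; upper-closed    = λ {p} {q} → Up-closed {p} {q}
    ; lower-open      = λ {p} → Lo-open {p}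
    ; upper-open      = λ {q} → Up-open {q}
    ; disjoint        = λ {q} → Lo-Up-disjoint {q}
    ; located         = Lo-Up-located
    }

_÷_⟨_⟩ : (N : ℕ) .{{_ : NonZero N}} (x : ℝ) → Pos x → ℝ
N ÷ x ⟨ 0<x ⟩ = Quotient.quotient (ι N) (0<ι N) x 0<x

IsFloor : ℝ → ℕ → Set
IsFloor y m = ¬ upper y (ι m) × upper y (ι (suc m))

-- The floor of a real is not computable, so T_N is given by its graph:
-- IsT N x y says that y = T_N(x), for x in [0,1].

IsT : (N : ℕ) .{{_ : NonZero N}} → ℝ → ℝ → Set
IsT N x y =
    (x ≃ fromℚ 0ℚ × y ≃ fromℚ 0ℚ)
  ⊎ (Σ[ 0<x ∈ Pos x ] ∃[ m ] IsFloor (N ÷ x ⟨ 0<x ⟩) m × y ≃ (N ÷ x ⟨ 0<x ⟩) − ι m)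

-- d n is the n-th digit of x for n ≥ 1; the value d 0 is irrelevant,
-- here and in everything below.  orbit n is T_Nⁿ(x).

record IsNCFDigits (N : ℕ) .{{_ : NonZero N}} (x : ℝ) (d : ℕ → ℕ) : Set₁ where
  field
    orbit      : ℕ → ℝ
    orbit-zero : orbit 0 ≃ x
    orbit-suc  : ∀ n → IsT N (orbit n) (orbit (suc n))
    orbit-pos  : ∀ n → Pos (orbit n)
    digit      : ∀ n → IsFloor (N ÷ orbit n ⟨ orbit-pos n ⟩) (d (suc n))

-- Index shifted by one: num N d i = p_{i-1} and den N d i = q_{i-1}.

num den : (N : ℕ) (d : ℕ → ℕ) → ℕ → ℕ
num N d 0             = 1
num N d 1             = 0
num N d (suc (suc i)) = d (suc i) * num N d (suc i) + N * num N d i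
den N d 0             = 0
den N d 1             = 1
den N d (suc (suc i)) = d (suc i) * den N d (suc i) + N * den N d i

-- p_j is a multiple of N for j ≥ 0, so p_j / N below is exact.

N∣p : ∀ N d j → N ∣ num N d (suc j)
N∣p N d zero    = N ∣0
N∣p N d (suc j) = ∣m∣n⇒∣m+n (∣n⇒∣m*n (d (suc j)) (N∣p N d j)) (m∣m*n (num N d j))

-- sumPQ N d m = Σ_{j=-1}^{m-2} (p_j + q_j)          (m terms)
-- sumP/NQ N d m = Σ_{j=0}^{m-1} (p_j / N + q_j)     (m terms)

sumPQ : (N : ℕ) (d : ℕ → ℕ) → ℕ → ℕ
sumPQ N d m = sum (applyUpTo (λ i → num N d i + den N d i) m)

sumP/NQ : (N : ℕ) .{{_ : NonZero N}} (d : ℕ → ℕ) → ℕ → ℕ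
sumP/NQ N d m = sum (applyUpTo (λ j → num N d (suc j) / N + den N d (suc j)) m)

Letter : Set
Letter = Fin 2

pattern 𝟎 = zero
pattern 𝟏 = suc zero

Word : Set
Word = List Letter

infixr 8 _^ʷ_

_^ʷ_ : Word → ℕ → Word
w ^ʷ n = concat (replicate n w)

Seq : Set
Seq = ℕ → Letter

Substitution : Set
Substitution = Letter → List⁺ Letter

applyʷ : Substitution → Word → Word
applyʷ σ = concatMap (λ a → toList (σ a))

-- concat∞ w v is the infinite word  w v₀ v₁ v₂ ⋯

concat∞ : List⁺ Letter → (ℕ → List⁺ Letter) → Seq
concat∞ (a ∷ _)      v zero    = a
concat∞ (_ ∷ [])     v (suc n) = concat∞ (v 0) (λ i → v (suc i)) n
concat∞ (_ ∷ b ∷ bs) v (suc n) = concat∞ (b ∷ bs) v n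

applyˢ : Substitution → Seq → Seq
applyˢ σ u = concat∞ (σ (u 0)) (λ i → σ (u (suc i)))

-- ω is generated by the substitutions σ 1, σ 2, … (σ 0 is not used).

IsDirectedBy : (ℕ → Substitution) → Seq → Set
IsDirectedBy σ ω = Σ[ W ∈ (ℕ → Seq) ]
    (∀ i → W 1 i ≡ ω i)
  × (∀ n → 1 ≤ n → ∀ i → W n i ≡ applyˢ (σ n) (W (suc n)) i)

-- compose σ n w = σ₁ (σ₂ (⋯ (σₙ w)))

compose : (ℕ → Substitution) → ℕ → Word → Word
compose σ zero    w = w
compose σ (suc n) w = compose σ n (applyʷ (σ (suc n)) w)

factorAt : Seq → ℕ → ℕ → Word
factorAt ν i n = applyUpTo (λ j → ν (i + j)) n

-- p n is the number of distinct factors of ν of length n, witnessed by a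
-- repetition-free enumeration of these factors; so p is unique.

IsComplexity : Seq → (ℕ → ℕ) → Set
IsComplexity ν p = ∀ n → Σ[ ws ∈ List Word ]
    Unique ws
  × length ws ≡ p n
  × (∀ w → w ∈ ws ⇔ (∃[ i ] w ≡ factorAt ν i n))

module _ (N : ℕ) .{{_ : NonZero N}} (d : ℕ → ℕ) where

  σ σ̂ : ℕ → Substitution
  σ n 𝟎 = replicate (d n) 𝟎 ++⁺ List⁺.replicate N (≢-nonZero⁻¹ N) 𝟏
  σ n 𝟏 = List⁺.[ 𝟎 ]
  σ̂ n 𝟎 = replicate (d n) 𝟎 ++⁺ List⁺.[ 𝟏 ]
  σ̂ n 𝟏 = List⁺.replicate N (≢-nonZero⁻¹ N) 𝟎

  IsNCFSequence IsDualNCFSequence : Seq → Set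
  IsNCFSequence     = IsDirectedBy σ
  IsDualNCFSequence = IsDirectedBy σ̂

  -- The words carrying an index k are meaningful for k ≥ 1 only, except
  -- for T 0; at k = 0 the remaining ones have a harmless default value.

  Σʷ Σ̂ʷ : ℕ → Word
  Σʷ k = compose σ k [ 𝟏 ]
  Σ̂ʷ k = compose σ̂ (k ∸ 1) [ 𝟎 ]

  S Ŝ T T̂ : ℕ → Word
  S zero    = []
  S (suc k) = Σʷ (suc k) ^ʷ d (suc k) ++ S k
  Ŝ zero    = []
  Ŝ (suc k) = Σ̂ʷ (suc k) ^ʷ d (suc k) ++ Ŝ k
  T zero    = [ 𝟏 ] ^ʷ (N ∸ 1)
  T (suc k) = Σʷ (suc k) ^ʷ (N ∸ 1) ++ S (suc k)
  T̂ zero    = []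
  T̂ (suc k) = Σ̂ʷ (suc k) ^ʷ (N ∸ 1) ++ Ŝ (suc k)

  s t ŝ t̂ : ℕ → ℕ
  s k = length (S k)
  t k = length (T k)
  ŝ k = length (Ŝ k)
  t̂ k = length (T̂ k)

{-# OPTIONS --safe #-}
-- On a binary alphabet p(n+1) − p(n) is the number of left special factors of length n.  For both
-- sequences these are the prefix of length n and, exactly when s_k < n ≤ t_k for some k, the prefix
-- of length n of T_k, which leaves the sequence right after S_k; summing the increments gives the
-- formulas.
-- To find the left special factors, factor σ̂_n as φ^{d_n} ∘ η with φ : 0 ↦ 0, 1 ↦ 01 and
-- η : 0 ↦ 1, 1 ↦ 0^N.  Both maps can be desubstituted at a left special factor: under φ it is a
-- prefix of φ(z)0 and under η a prefix of η(z), with z left special in the preimage, except for the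
-- prefixes of 0^{N−1} that η creates; these grow into the words T̂_k.  Finally ω = ψ(ν) for a sequence ν
-- directed by the dual substitutions, where ψ is η followed by the exchange of letters, and this
-- last step only adds T_0 = 1^{N−1}.

module Submission where

open import Defs
open import Data.Nat.Base using (ℕ; _+_; _*_; _∸_; _≤_; _<_; NonZero)
open import Data.Product.Base using (Σ-syntax; _×_)
open import Relation.Binary.PropositionalEquality using (_≡_)

open import Data.Fin.Properties using () renaming (_≟_ to _≟ᶠ_)
import Data.Integer.Base as ℤ
import Data.Integer.Properties as ℤ
open import Data.List.Base using (List; []; _∷_; [_]; _++_; length; replicate; concat; concatMap; applyUpTo; take; map)
open import Data.List.Membership.Propositional using (_∈_)
open import Data.List.Membership.Propositional.Properties using (∈-++⁺ˡ; ∈-++⁺ʳ; ∈-++⁻; ∈-map⁺; ∈-map⁻)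
open import Data.List.NonEmpty.Base as List⁺ using (List⁺; _∷_; toList; _++⁺_)
open import Data.List.Properties
  using (++-assoc; ++-identityʳ; length-++; length-map; length-replicate; length-applyUpTo; length-take; ≡-dec;
         ∷-injectiveˡ; ∷-injectiveʳ; concatMap-++; concatMap-cong; map-replicate; map-concatMap; applyUpTo-∷ʳ)
open import Data.List.Relation.Binary.Prefix.Heterogeneous using (Prefix; []; _∷_; _++ᵖ_)
import Data.List.Relation.Binary.Prefix.Heterogeneous.Properties as Prefix
open import Data.List.Relation.Unary.All using ([]; _∷_)
open import Data.List.Relation.Unary.AllPairs using ([]; _∷_)
open import Data.List.Relation.Unary.Any using (here; there)
open import Data.List.Relation.Unary.Unique.Propositional using (Unique)
import Data.List.Relation.Unary.Unique.Propositional.Properties as Unique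
open import Data.Nat.Base using (zero; suc; z≤n; s≤s; _/_)
open import Data.Nat.DivMod using (m*n/n≡m)
open import Data.Nat.ListAction using (sum)
open import Data.Nat.ListAction.Properties using (sum-++)
open import Data.Nat.Properties
open import Data.Nat.Tactic.RingSolver using (solve-∀)
open import Data.Product.Base using (∃-syntax; _,_; proj₁; proj₂)
open import Data.Rational.Base as ℚ using (0ℚ; 1ℚ; toℚᵘ)
import Data.Rational.Properties as ℚ
import Data.Rational.Unnormalised.Base as ℚᵘ
import Data.Rational.Unnormalised.Properties as ℚᵘ
open import Data.Sum.Base using (_⊎_; inj₁; inj₂; map₂)
open import Function.Base using (_∘_)
open import Function.Bundles using (mk⇔; Equivalence)
open import Relation.Binary.PropositionalEquality
  using (_≢_; refl; sym; trans; cong; cong₂; subst; subst₂; module ≡-Reasoning)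
open import Relation.Nullary using (¬_; Dec; yes; no; contradiction)
open import Relation.Nullary.Decidable using (map′)

open import Data.List.Membership.DecPropositional (≡-dec (_≟ᶠ_ {2})) using (_∈?_)

-- The bound d_n ≥ N gives t_k < s_{k+1}: the intervals (s_k, t_k] do not overlap, so no length has
-- more than two left special words, and p(n) ≤ 2n follows. One obstacle is that `IsComplexity` asks
-- for an explicit list, while occurrence in an infinite word is not decidable a priori and no
-- recurrence bound is at hand. The classification of left special words removes it: prefixes are
-- left special, so every factor, even one met only at position 0, extends to the left, and it
-- extends by both letters exactly when it stands in a finite explicit list. The descent through the
-- infinitely many levels ends by length: every φ removed costs a nonempty left special word at
-- least one letter, so a word of length n is exhausted after at most n levels.

-- Digits are at least N

ι-suc : ∀ n → ι (suc n) ≡ 1ℚ ℚ.+ ι n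
ι-suc n = ℚ.toℚᵘ-injective (begin-equality
  toℚᵘ (ι (suc n))                         ≃⟨ ℚ.toℚᵘ-fromℚᵘ (ℚᵘ.mkℚᵘ (ℤ.+ suc n) 0) ⟩
  ℚᵘ.mkℚᵘ (ℤ.+ suc n) 0                    ≃⟨ ℚᵘ.*≡* (cong (ℤ._* ℤ.1ℤ) (cong (λ i → ℤ.1ℤ ℤ.+ i) (sym (ℤ.*-identityʳ (ℤ.+ n))))) ⟩
  ℚᵘ.1ℚᵘ ℚᵘ.+ ℚᵘ.mkℚᵘ (ℤ.+ n) 0            ≃⟨ ℚᵘ.+-congʳ ℚᵘ.1ℚᵘ (ℚ.toℚᵘ-fromℚᵘ (ℚᵘ.mkℚᵘ (ℤ.+ n) 0)) ⟨
  toℚᵘ 1ℚ ℚᵘ.+ toℚᵘ (ι n)                  ≃⟨ ℚ.toℚᵘ-homo-+ 1ℚ (ι n) ⟨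
  toℚᵘ (1ℚ ℚ.+ ι n)                        ∎)
  where open ℚᵘ.≤-Reasoning

ι-mono : ∀ {m n} → m ≤ n → ι m ℚ.≤ ι n
ι-mono {m} {n} m≤n with m≤n⇒m<n∨m≡n m≤n
... | inj₂ refl = ℚ.≤-refl
ι-mono {m} {suc n} _ | inj₁ (s≤s m≤n) = ℚ.≤-trans (ι-mono m≤n)
  (subst₂ ℚ._≤_ (ℚ.+-identityˡ (ι n)) (sym (ι-suc n)) (ℚ.+-monoˡ-≤ (ι n) (ℚ.<⇒≤ (ℚ.positive⁻¹ 1ℚ))))

module _ {N : ℕ} .{{_ : NonZero N}} (x : ℝ) (x∈ : x ∈[0,1]) {d : ℕ → ℕ} (digits : IsNCFDigits N x d) where
  open IsNCFDigits digits
  open ℝ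

  orbit-≤-1 : ∀ n → ¬ lower (orbit n) 1ℚ
  orbit-≤-1 zero    l = proj₂ x∈ (Equivalence.to (proj₁ (orbit-zero 1ℚ)) l)
  orbit-≤-1 (suc n) l with orbit-suc n
  ... | inj₁ (orbit≃0 , _) = ℚ.<-irrefl refl (Equivalence.to (proj₁ (orbit≃0 0ℚ)) (orbit-pos n))
  ... | inj₂ (0<y , m , (_ , up) , y≃) = disjoint (N ÷ orbit n ⟨ 0<y ⟩) {1ℚ ℚ.+ ι m}
    (Equivalence.to (proj₁ (y≃ 1ℚ)) l) (subst (upper (N ÷ orbit n ⟨ 0<y ⟩)) (ι-suc m) up)

  -- With y the current orbit point, N/y < d + 1 is witnessed by a rational r < y with N < (d + 1)
  -- r. As y ≤ 1, also r ≤ 1, hence N < d + 1.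
  digit-≥ : ∀ n → N ≤ d (suc n)
  digit-≥ n with proj₂ (digit n)
  ... | r , 0<r , l , N<dr = ≮⇒≥ λ d<N → ℚ.<-irrefl refl (ℚ.<-≤-trans N<dr
      (ℚ.≤-trans (ℚ.*-monoʳ-≤-nonNeg r {{ℚ.nonNegative (ℚ.<⇒≤ 0<r)}} (ι-mono d<N))
      (subst (ι N ℚ.* r ℚ.≤_) (ℚ.*-identityʳ (ι N))
        (ℚ.*-monoˡ-≤-nonNeg (ι N) {{ℚ.normalize-nonNeg N 1}} r≤1))))
    where
    r≤1 : r ℚ.≤ 1ℚ
    r≤1 = ℚ.≮⇒≥ λ 1<r → orbit-≤-1 n (lower-closed (orbit n) 1<r l)

-- Infinite words and their images under morphisms

tail : Seq → Seq
tail u i = u (suc i)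

infix 4 _⊑_ _≼_ _⇝_

_⊑_ : Word → Word → Set
_⊑_ = Prefix _≡_

data _≼_ : Word → Seq → Set where
  []  : ∀ {u} → [] ≼ u
  _∷_ : ∀ {a w u} → u 0 ≡ a → w ≼ tail u → a ∷ w ≼ u

⊑-refl : ∀ {w} → w ⊑ w
⊑-refl {[]}    = []
⊑-refl {a ∷ w} = refl ∷ ⊑-refl

⊑-trans : ∀ {v w z} → v ⊑ w → w ⊑ z → v ⊑ z
⊑-trans = Prefix.trans trans

⊑-++ : ∀ v {w} → v ⊑ v ++ w
⊑-++ v {w} = ⊑-refl ++ᵖ w

++-monoʳ-⊑ : ∀ v {w z} → w ⊑ z → v ++ w ⊑ v ++ z
++-monoʳ-⊑ []      p = p
++-monoʳ-⊑ (a ∷ v) p = refl ∷ ++-monoʳ-⊑ v p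

⊑⇒≡take : ∀ {w z} → w ⊑ z → w ≡ take (length w) z
⊑⇒≡take []         = refl
⊑⇒≡take (refl ∷ p) = cong (_ ∷_) (⊑⇒≡take p)

take-⊑ : ∀ n (w : Word) → take n w ⊑ w
take-⊑ zero    w       = []
take-⊑ (suc n) []      = []
take-⊑ (suc n) (a ∷ w) = refl ∷ take-⊑ n w

⊑-comparable : ∀ {v w z} → v ⊑ z → w ⊑ z → length v ≤ length w → v ⊑ w
⊑-comparable []         q          _         = []
⊑-comparable (refl ∷ p) (refl ∷ q) (s≤s v≤w) = refl ∷ ⊑-comparable p q v≤w

⊑-≼-trans : ∀ {w z u} → w ⊑ z → z ≼ u → w ≼ u
⊑-≼-trans []         _       = []
⊑-≼-trans (refl ∷ p) (x ∷ q) = x ∷ ⊑-≼-trans p q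

≼-comparable : ∀ {v w u} → v ≼ u → w ≼ u → length v ≤ length w → v ⊑ w
≼-comparable []      q       _         = []
≼-comparable (x ∷ p) (y ∷ q) (s≤s v≤w) = trans (sym x) y ∷ ≼-comparable p q v≤w

≼-resp-≗ : ∀ {w u v} → (∀ i → u i ≡ v i) → w ≼ u → w ≼ v
≼-resp-≗ e []      = []
≼-resp-≗ e (x ∷ p) = trans (sym (e 0)) x ∷ ≼-resp-≗ (e ∘ suc) p

applyUpTo-≼ : ∀ u n → applyUpTo u n ≼ u
applyUpTo-≼ u zero    = []
applyUpTo-≼ u (suc n) = refl ∷ applyUpTo-≼ (tail u) n

≼⇒≡applyUpTo : ∀ {w u} → w ≼ u → w ≡ applyUpTo u (length w)
≼⇒≡applyUpTo []      = refl
≼⇒≡applyUpTo (x ∷ p) = cong₂ _∷_ (sym x) (≼⇒≡applyUpTo p)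

≼-extend : ∀ {w u} → w ≼ u → ∃[ a ] w ++ [ a ] ≼ u
≼-extend {u = u} [] = u 0 , refl ∷ []
≼-extend (x ∷ p)    = let a , q = ≼-extend p in a , x ∷ q

dropWord : Word → Seq → Seq
dropWord []      u = u
dropWord (_ ∷ w) u = dropWord w (tail u)

≼-++⁻ : ∀ v {w u} → v ++ w ≼ u → w ≼ dropWord v u
≼-++⁻ []      p       = p
≼-++⁻ (_ ∷ v) (_ ∷ p) = ≼-++⁻ v p

≼-split : ∀ v {w u} → w ≼ u → v ≼ u → (w ⊑ v) ⊎ (∃[ r ] (w ≡ v ++ r) × (r ≼ dropWord v u))
≼-split v       []      q       = inj₁ []
≼-split []      (x ∷ p) q       = inj₂ (_ , refl , x ∷ p)
≼-split (b ∷ v) (x ∷ p) (y ∷ q) with ≼-split v p q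
... | inj₁ w⊑v              = inj₁ (trans (sym x) y ∷ w⊑v)
... | inj₂ (r , refl , r≼) = inj₂ (r , cong (_∷ (v ++ r)) (trans (sym x) y) , r≼)

data _⇝_ : Seq → Seq → Set where
  here : ∀ {u} → u ⇝ u
  skip : ∀ {u v} → tail u ⇝ v → u ⇝ v

⇝-trans : ∀ {u v w} → u ⇝ v → v ⇝ w → u ⇝ w
⇝-trans here     q = q
⇝-trans (skip p) q = skip (⇝-trans p q)

⇝-dropWord : ∀ w {u} → u ⇝ dropWord w u
⇝-dropWord []      = here
⇝-dropWord (_ ∷ w) = skip (⇝-dropWord w)

Factor : Seq → Word → Set
Factor u w = ∃[ v ] u ⇝ v × w ≼ v

LeftSpecial : Seq → Word → Set
LeftSpecial u w = ∀ a → Factor u (a ∷ w)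

Factor-⊑ : ∀ {u w z} → w ⊑ z → Factor u z → Factor u w
Factor-⊑ p (v , u⇝v , q) = v , u⇝v , ⊑-≼-trans p q

LeftSpecial-⊑ : ∀ {u w z} → w ⊑ z → LeftSpecial u z → LeftSpecial u w
LeftSpecial-⊑ p ls a = Factor-⊑ (refl ∷ p) (ls a)

Factor-++ : ∀ v {u w} → Factor u (v ++ w) → Factor u w
Factor-++ v (z , u⇝z , p) = dropWord v z , ⇝-trans u⇝z (⇝-dropWord v) , ≼-++⁻ v p

Morphism : Set
Morphism = Letter → Word

-- Expresses u = h(v) through finite prefixes, so that sequences need only be compared letter by
-- letter and no function extensionality is needed.
IsImage : Morphism → Seq → Seq → Set
IsImage h v u = ∀ {w} → w ≼ v → concatMap h w ≼ u

module _ {h : Morphism} where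

  image-head : ∀ {v u} → IsImage h v u → h (v 0) ≼ u
  image-head im = ⊑-≼-trans (⊑-++ _) (im (refl ∷ []))

  image-tail : ∀ {v u} → IsImage h v u → IsImage h (tail v) (dropWord (h (v 0)) u)
  image-tail {v} im p = ≼-++⁻ (h (v 0)) (im (refl ∷ p))

  image-⇝ : ∀ {v u v′} → IsImage h v u → v ⇝ v′ → ∃[ u′ ] u ⇝ u′ × IsImage h v′ u′
  image-⇝ im here = _ , here , im
  image-⇝ {v} im (skip p) = let u′ , q , im′ = image-⇝ (image-tail im) p in
    u′ , ⇝-trans (⇝-dropWord (h (v 0))) q , im′

  image-Factor : ∀ {v u w} → IsImage h v u → Factor v w → Factor u (concatMap h w)
  image-Factor im (v′ , p , q) = let u′ , r , im′ = image-⇝ im p in u′ , r , im′ q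

  -- The position reached in the image u lies in the image pre ++ a ∷ suf of a letter of v.
  record Located (v u : Seq) : Set where
    constructor located
    field
      {source}  : Seq
      reach     : v ⇝ source
      pre suf   : Word
      a         : Letter
      split     : h (source 0) ≡ pre ++ a ∷ suf
      occurs    : a ∷ suf ≼ u
      continues : IsImage h (tail source) (dropWord suf (tail u))

  -- The walk to the position keeps the current source letter together with the passed and the
  -- remaining part of its image; when the block is used up, the next source letter is entered,
  -- which needs its image to be nonempty.
  locate : (∀ a → h a ≢ []) → ∀ {v u u′} → IsImage h v u → u ⇝ u′ → Located v u′
  locate nonempty {v} {u} im u⇝u′ = first u⇝u′ (image-head im) (image-tail im)
    where
    go : ∀ {v u u′} pre a suf → h (v 0) ≡ pre ++ a ∷ suf → u ⇝ u′ →
         a ∷ suf ≼ u → IsImage h (tail v) (dropWord suf (tail u)) → Located v u′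
    go pre a suf eq here p im = located here pre suf a eq p im
    go {v} pre a [] eq (skip r) (x ∷ p) im with h (v 1) in eq₁ | image-head im | image-tail im
    ... | []      | _ | _ = contradiction eq₁ (nonempty (v 1))
    ... | b ∷ suf | q | im′ with go [] b suf eq₁ r q im′
    ... | located reach pre′ suf′ a′ split occ cont = located (skip reach) pre′ suf′ a′ split occ cont
    go pre a (b ∷ suf) eq (skip r) (x ∷ p) im =
      go (pre ++ [ a ]) b suf (trans eq (sym (++-assoc pre [ a ] (b ∷ suf)))) r p im
    first : ∀ {v u u′} → u ⇝ u′ → h (v 0) ≼ u →
            IsImage h (tail v) (dropWord (h (v 0)) u) → Located v u′
    first {v} r p im with h (v 0) in eq₁
    ... | []      = contradiction eq₁ (nonempty (v 0))
    ... | b ∷ suf = go [] b suf eq₁ r p im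

concatMap-concatMap : ∀ (h g : Morphism) w → concatMap h (concatMap g w) ≡ concatMap (concatMap h ∘ g) w
concatMap-concatMap h g []      = refl
concatMap-concatMap h g (a ∷ w) =
  trans (concatMap-++ h (g a) (concatMap g w)) (cong (concatMap h (g a) ++_) (concatMap-concatMap h g w))

concatMap-⊑ : ∀ (h : Morphism) {w z} → w ⊑ z → concatMap h w ⊑ concatMap h z
concatMap-⊑ h []                    = []
concatMap-⊑ h (_∷_ {a = a} refl p) = ++-monoʳ-⊑ (h a) (concatMap-⊑ h p)

image-cong : ∀ {h g : Morphism} {v u} → (∀ a → h a ≡ g a) → IsImage h v u → IsImage g v u
image-cong {u = u} e im {w} p = subst (_≼ u) (concatMap-cong e w) (im p)

image-∘ : ∀ {h g v u z} → IsImage g v u → IsImage h u z → IsImage (concatMap h ∘ g) v z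
image-∘ {h} {g} {z = z} im im′ {w} p = subst (_≼ z) (concatMap-concatMap h g w) (im′ (im p))

length-concatMap-≥ : ∀ (h : Morphism) → (∀ a → 1 ≤ length (h a)) → ∀ w → length w ≤ length (concatMap h w)
length-concatMap-≥ h 1≤h []      = z≤n
length-concatMap-≥ h 1≤h (a ∷ w) = subst (suc (length w) ≤_) (sym (length-++ (h a)))
  (+-mono-≤ (1≤h a) (length-concatMap-≥ h 1≤h w))

image-cover : ∀ {h v u} → (∀ a → 1 ≤ length (h a)) → IsImage h v u →
              ∀ {w} → w ≼ u → ∃[ z ] z ≼ v × length z ≡ length w × w ⊑ concatMap h z
image-cover {h} {v} 1≤h im {w} p = z , applyUpTo-≼ v (length w) , z≡ ,
    ≼-comparable p (im (applyUpTo-≼ v (length w))) (≤-trans (≤-reflexive (sym z≡)) (length-concatMap-≥ h 1≤h z))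
  where
  z = applyUpTo v (length w)
  z≡ = length-applyUpTo v (length w)

-- Cancels the inner morphism, as a converse to `image-∘`: a prefix of `u` is completed to whole
-- `g`-blocks, on which `h` after `g` is `k`.
image-factor : ∀ {h g k v u z} → (∀ a → 1 ≤ length (g a)) → (∀ a → concatMap h (g a) ≡ k a) →
               IsImage g v u → IsImage k v z → IsImage h u z
image-factor {h} {g} {k} {z = z} 1≤g e im im′ {w} p =
  let y , y≼ , _ , w⊑ = image-cover 1≤g im p in
  ⊑-≼-trans (subst (concatMap h w ⊑_)
    (trans (concatMap-concatMap h g y) (concatMap-cong e y)) (concatMap-⊑ h w⊑)) (im′ y≼)

concat∞-≼ : ∀ a as v n → a ∷ as ++ concat (applyUpTo (toList ∘ v) n) ≼ concat∞ (a ∷ as) v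
concat∞-≼ a []       v zero    = refl ∷ []
concat∞-≼ a []       v (suc n) = refl ∷ concat∞-≼ (List⁺.head (v 0)) (List⁺.tail (v 0)) (v ∘ suc) n
concat∞-≼ a (b ∷ bs) v n       = refl ∷ concat∞-≼ b bs v n

module _ (τ : Substitution) where

  private
    concatMap-applyUpTo : ∀ u n → concatMap (toList ∘ τ) (applyUpTo u n) ≡ concat (applyUpTo (toList ∘ τ ∘ u) n)
    concatMap-applyUpTo u zero    = refl
    concatMap-applyUpTo u (suc n) = cong (toList (τ (u 0)) ++_) (concatMap-applyUpTo (tail u) n)

  applyˢ-image : ∀ u → IsImage (toList ∘ τ) u (applyˢ τ u)
  applyˢ-image u {[]}    p       = []
  applyˢ-image u {a ∷ w} (x ∷ p) rewrite sym x | ≼⇒≡applyUpTo p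
    | concatMap-applyUpTo (tail u) (length w) = concat∞-≼ _ _ (τ ∘ tail u) (length w)

-- Desubstitution of φ and η

replicate-∷ʳ : ∀ n (a : Letter) → replicate n a ++ [ a ] ≡ replicate (suc n) a
replicate-∷ʳ zero    a = refl
replicate-∷ʳ (suc n) a = cong (a ∷_) (replicate-∷ʳ n a)

replicate-++ : ∀ m n (a : Letter) → replicate m a ++ replicate n a ≡ replicate (m + n) a
replicate-++ zero    n a = refl
replicate-++ (suc m) n a = cong (a ∷_) (replicate-++ m n a)

replicate-split : ∀ n {a b : Letter} pre {suf} → replicate n a ≡ pre ++ b ∷ suf →
                  a ≡ b × suf ≡ replicate (length suf) a × length suf < n
replicate-split (suc n) []        refl = refl , cong (λ m → replicate m _) (sym (length-replicate n)) , s≤s (≤-reflexive (length-replicate n))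
replicate-split (suc n) (c ∷ pre) eq with replicate-split n pre (∷-injectiveʳ eq)
... | e , e′ , lt = e , e′ , m<n⇒m<1+n lt

φ : Morphism
φ 𝟎 = 𝟎 ∷ []
φ 𝟏 = 𝟎 ∷ 𝟏 ∷ []

φ-nonempty : ∀ a → φ a ≢ []
φ-nonempty 𝟎 ()
φ-nonempty 𝟏 ()

φ-replicate : ∀ n → concatMap φ (replicate n 𝟎) ≡ replicate n 𝟎
φ-replicate zero    = refl
φ-replicate (suc n) = cong (𝟎 ∷_) (φ-replicate n)

𝟎≢𝟏 : ∀ {ℓ} {A : Set ℓ} {a : Letter} → a ≡ 𝟎 → a ≡ 𝟏 → A
𝟎≢𝟏 refl ()

module _ {v u : Seq} (im : IsImage φ v u) where

  φ-image-head : u 0 ≡ 𝟎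
  φ-image-head with v 0 | image-head im
  ... | 𝟎 | x ∷ _ = x
  ... | 𝟏 | x ∷ _ = x

  -- Both images under φ begin with 0, so the image of a prefix is always followed by a 0.
  φ-image-≼ : ∀ {w} → w ≼ v → concatMap φ w ++ [ 𝟎 ] ≼ u
  φ-image-≼ {w} p with ≼-extend p
  ... | a , q = ⊑-≼-trans (subst (concatMap φ w ++ [ 𝟎 ] ⊑_) (sym (concatMap-++ φ w [ a ])) (++-monoʳ-⊑ _ (begins a))) (im q)
    where
    begins : ∀ a → [ 𝟎 ] ⊑ concatMap φ [ a ]
    begins 𝟎 = refl ∷ []
    begins 𝟏 = refl ∷ []

φ𝟎-mono : ∀ {y z} → y ⊑ z → concatMap φ y ++ [ 𝟎 ] ⊑ concatMap φ z ++ [ 𝟎 ]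
φ𝟎-mono {z = []}    []         = refl ∷ []
φ𝟎-mono {z = 𝟎 ∷ z} []         = refl ∷ []
φ𝟎-mono {z = 𝟏 ∷ z} []         = refl ∷ []
φ𝟎-mono {z = 𝟎 ∷ z} (refl ∷ p) = refl ∷ φ𝟎-mono p
φ𝟎-mono {z = 𝟏 ∷ z} (refl ∷ p) = refl ∷ refl ∷ φ𝟎-mono p

module _ {v u : Seq} (im : IsImage φ v u) where

  -- φ(a) ends with a, so the two left neighbours of `w` stay distinct; the final 0 comes for free.
  φ-image-LeftSpecial : ∀ {w} → LeftSpecial v w → LeftSpecial u (concatMap φ w ++ [ 𝟎 ])
  φ-image-LeftSpecial {w} ls a with ls a
  ... | v′ , v⇝v′ , p with image-⇝ im v⇝v′
  ... | u′ , u⇝u′ , im′ = drop-pre a (u′ , u⇝u′ , φ-image-≼ im′ p)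
    where
    drop-pre : ∀ a → Factor u (concatMap φ (a ∷ w) ++ [ 𝟎 ]) → Factor u (a ∷ concatMap φ w ++ [ 𝟎 ])
    drop-pre 𝟎 f = f
    drop-pre 𝟏 f = Factor-++ [ 𝟎 ] f

  -- In a concatenation of the blocks 0 and 01 a block starts at every 0 and nowhere else. The
  -- letter before a 0 therefore ends its block and equals the source letter.
  φ-desubstitute : ∀ {a w} → Factor u (a ∷ 𝟎 ∷ w) →
    ∃[ v′ ] v ⇝ v′ × v′ 0 ≡ a × ∃[ u′ ] IsImage φ (tail v′) u′ × 𝟎 ∷ w ≼ u′
  φ-desubstitute (z , u⇝z , p) with locate φ-nonempty im u⇝z
  ... | located {v′} reach pre suf b split occ cont with v′ 0 in eq
  φ-desubstitute (z , u⇝z , x ∷ p) | located {v′} reach [] [] 𝟎 refl (y ∷ occ) cont | 𝟎 =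
    v′ , reach , trans eq (trans (sym y) x) , _ , cont , p
  φ-desubstitute (z , u⇝z , x ∷ p) | located {v′} reach (_ ∷ []) suf b () occ cont | 𝟎
  φ-desubstitute (z , u⇝z , x ∷ p) | located {v′} reach (_ ∷ _ ∷ _) suf b () occ cont | 𝟎
  φ-desubstitute (z , u⇝z , x ∷ y ∷ p) | located {v′} reach [] (𝟏 ∷ []) 𝟎 refl (_ ∷ y′ ∷ occ) cont | 𝟏 =
    𝟎≢𝟏 y y′
  φ-desubstitute (z , u⇝z , x ∷ p) | located {v′} reach (𝟎 ∷ []) [] 𝟏 refl (y ∷ occ) cont | 𝟏 =
    v′ , reach , trans eq (trans (sym y) x) , _ , cont , p
  φ-desubstitute (z , u⇝z , x ∷ p) | located {v′} reach (_ ∷ _ ∷ []) suf b () occ cont | 𝟏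
  φ-desubstitute (z , u⇝z , x ∷ p) | located {v′} reach (_ ∷ _ ∷ _ ∷ _) suf b () occ cont | 𝟏

  φ-image-no-𝟏𝟏 : ¬ Factor u (𝟏 ∷ 𝟏 ∷ [])
  φ-image-no-𝟏𝟏 (z , u⇝z , p) with locate φ-nonempty im u⇝z
  ... | located {v′} reach pre suf b split occ cont with v′ 0
  φ-image-no-𝟏𝟏 (z , u⇝z , x ∷ p) | located {v′} reach [] [] 𝟎 refl (y ∷ occ) cont | 𝟎 = 𝟎≢𝟏 y x
  φ-image-no-𝟏𝟏 (z , u⇝z , x ∷ p) | located {v′} reach (_ ∷ []) suf b () occ cont | 𝟎
  φ-image-no-𝟏𝟏 (z , u⇝z , x ∷ p) | located {v′} reach (_ ∷ _ ∷ _) suf b () occ cont | 𝟎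
  φ-image-no-𝟏𝟏 (z , u⇝z , x ∷ p) | located {v′} reach [] (𝟏 ∷ []) 𝟎 refl (y ∷ occ) cont | 𝟏 = 𝟎≢𝟏 y x
  φ-image-no-𝟏𝟏 (z , u⇝z , x ∷ y ∷ p) | located {v′} reach (𝟎 ∷ []) [] 𝟏 refl occ cont | 𝟏 =
    𝟎≢𝟏 (φ-image-head cont) y
  φ-image-no-𝟏𝟏 (z , u⇝z , x ∷ p) | located {v′} reach (_ ∷ _ ∷ []) suf b () occ cont | 𝟏
  φ-image-no-𝟏𝟏 (z , u⇝z , x ∷ p) | located {v′} reach (_ ∷ _ ∷ _ ∷ _) suf b () occ cont | 𝟏

-- Parallel decoding with one letter of lookahead: after a common 0 the next letter tells 0 from 01.
-- A last 0 without lookahead is left to the appended 0, and a block 01 spends two letters on one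
-- source letter; hence the drop in length.
φ-common : ∀ {v₁ v₂ u₁ u₂ w} → IsImage φ v₁ u₁ → IsImage φ v₂ u₂ → w ≼ u₁ → w ≼ u₂ →
  ∃[ z ] z ≼ v₁ × z ≼ v₂ × w ⊑ concatMap φ z ++ [ 𝟎 ] × length z ≤ length w ∸ 1
φ-common {w = []}        im₁ im₂ p₁ p₂ = [] , [] , [] , [] , z≤n
φ-common {w = c ∷ []}    im₁ im₂ (x ∷ p₁) p₂ = [] , [] , [] , trans (sym x) (φ-image-head im₁) ∷ [] , z≤n
φ-common {v₁} {v₂} {w = c ∷ b ∷ w} im₁ im₂ p₁ p₂
  with v₁ 0 in e₁ | v₂ 0 in e₂ | image-head im₁ | image-head im₂ | image-tail im₁ | image-tail im₂
φ-common {w = c ∷ b ∷ w} im₁ im₂ (x ∷ p₁) (y ∷ p₂) | 𝟎 | 𝟎 | x′ ∷ _ | _ | im₁′ | im₂′ =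
  let z , q₁ , q₂ , w⊑ , z≤ = φ-common im₁′ im₂′ p₁ p₂ in
  𝟎 ∷ z , e₁ ∷ q₁ , e₂ ∷ q₂ , trans (sym x) x′ ∷ w⊑ , s≤s z≤
φ-common {w = c ∷ b ∷ w} im₁ im₂ (x ∷ y ∷ p₁) (_ ∷ _ ∷ p₂) | 𝟏 | 𝟏 | x′ ∷ y′ ∷ _ | _ | im₁′ | im₂′ =
  let z , q₁ , q₂ , w⊑ , z≤ = φ-common im₁′ im₂′ p₁ p₂ in
  𝟏 ∷ z , e₁ ∷ q₁ , e₂ ∷ q₂ , trans (sym x) x′ ∷ trans (sym y) y′ ∷ w⊑ , s≤s (≤-trans z≤ (m∸n≤m _ 1))
φ-common {w = c ∷ b ∷ w} im₁ im₂ (_ ∷ x ∷ p₁) (_ ∷ y ∷ p₂) | 𝟎 | 𝟏 | _ | _ ∷ y′ ∷ _ | im₁′ | im₂′ =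
  𝟎≢𝟏 (φ-image-head im₁′) (trans x (trans (sym y) y′))
φ-common {w = c ∷ b ∷ w} im₁ im₂ (_ ∷ x ∷ p₁) (_ ∷ y ∷ p₂) | 𝟏 | 𝟎 | _ ∷ x′ ∷ _ | _ | im₁′ | im₂′ =
  𝟎≢𝟏 (φ-image-head im₂′) (trans y (trans (sym x) x′))

-- A left special word cannot begin with 1, as 11 does not occur. If it begins with 0, both
-- occurrences start at a block boundary and their left neighbours are letters of `v`.
φ-LeftSpecial⁻ : ∀ {v u b w} → IsImage φ v u → LeftSpecial u (b ∷ w) →
  ∃[ z ] LeftSpecial v z × b ∷ w ⊑ concatMap φ z ++ [ 𝟎 ] × length z ≤ length w
φ-LeftSpecial⁻ {b = 𝟏} im ls = contradiction (Factor-⊑ (refl ∷ refl ∷ []) (ls 𝟏)) (φ-image-no-𝟏𝟏 im)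
φ-LeftSpecial⁻ {b = 𝟎} im ls with φ-desubstitute im (ls 𝟎) | φ-desubstitute im (ls 𝟏)
... | v₀ , r₀ , e₀ , u₀ , im₀ , p₀ | v₁ , r₁ , e₁ , u₁ , im₁ , p₁ with φ-common im₀ im₁ p₀ p₁
... | z , q₀ , q₁ , w⊑ , z≤ = z , (λ { 𝟎 → v₀ , r₀ , e₀ ∷ q₀ ; 𝟏 → v₁ , r₁ , e₁ ∷ q₁ }) , w⊑ , z≤

-- The morphisms φ^j ∘ η, where M = N - 1

module Dual (M : ℕ) where

  -- χ j is φ^j ∘ η; in particular χ 0 is η and χ (d n) is σ̂_n.
  χ : ℕ → Morphism
  χ j 𝟎 = replicate j 𝟎 ++ [ 𝟏 ]
  χ j 𝟏 = replicate (suc M) 𝟎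

  χ-nonempty : ∀ j a → 1 ≤ length (χ j a)
  χ-nonempty j 𝟎 = subst (1 ≤_) (sym (length-++ (replicate j 𝟎))) (m≤n+m 1 (length (replicate j 𝟎)))
  χ-nonempty j 𝟏 = s≤s z≤n

  χ≢[] : ∀ j a → χ j a ≢ []
  χ≢[] j a eq with () ← subst ((1 ≤_) ∘ length) eq (χ-nonempty j a)

  φ∘χ : ∀ j a → concatMap φ (χ j a) ≡ χ (suc j) a
  φ∘χ j 𝟎 = trans (concatMap-++ φ (replicate j 𝟎) [ 𝟏 ])
    (trans (cong (_++ 𝟎 ∷ 𝟏 ∷ []) (φ-replicate j))
    (trans (sym (++-assoc (replicate j 𝟎) [ 𝟎 ] [ 𝟏 ])) (cong (_++ [ 𝟏 ]) (replicate-∷ʳ j 𝟎))))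
  φ∘χ j 𝟏 = φ-replicate (suc M)

  χˢ : ℕ → Substitution
  -- The digit sequence is constant, so the index 0 is an arbitrary choice.
  χˢ j = σ̂ (suc M) (λ _ → j) 0

  χˢ≗χ : ∀ j a → toList (χˢ j a) ≡ χ j a
  χˢ≗χ j 𝟎 = go j where
    go : ∀ j → toList (replicate j 𝟎 ++⁺ List⁺.[ 𝟏 ]) ≡ replicate j 𝟎 ++ [ 𝟏 ]
    go zero    = refl
    go (suc j) = cong (𝟎 ∷_) (go j)
  χˢ≗χ j 𝟏 = refl

  image : ℕ → Seq → Seq
  image j = applyˢ (χˢ j)

  image-isImage : ∀ j v → IsImage (χ j) v (image j v)
  image-isImage j v = image-cong (χˢ≗χ j) (applyˢ-image (χˢ j) v)

  -- Peels one φ off φ^(j+1) ∘ η; the intermediate sequence is built outright as `image j v`.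
  image-φ : ∀ {j v u} → IsImage (χ (suc j)) v u → IsImage φ (image j v) u
  image-φ {j} {v} im = image-factor (χ-nonempty j) (φ∘χ j) (image-isImage j v) im

  χ-image-head : ∀ {j v u} → IsImage (χ (suc j)) v u → u 0 ≡ 𝟎
  χ-image-head im = φ-image-head (image-φ im)

  χ-image-no-𝟏𝟏 : ∀ {j v u} → IsImage (χ (suc j)) v u → ¬ Factor u (𝟏 ∷ 𝟏 ∷ [])
  χ-image-no-𝟏𝟏 im = φ-image-no-𝟏𝟏 (image-φ im)

  χ-image-𝟎𝟏 : ∀ {j v u} → v 0 ≡ 𝟎 → IsImage (χ (suc j)) v u → Factor u (𝟎 ∷ 𝟏 ∷ [])
  χ-image-𝟎𝟏 {j} {u = u} v₀ im = Factor-++ (replicate j 𝟎)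
    (u , here , subst (_≼ u) eq (im (v₀ ∷ [])))
    where
    eq : concatMap (χ (suc j)) [ 𝟎 ] ≡ replicate j 𝟎 ++ 𝟎 ∷ 𝟏 ∷ []
    eq = trans (++-identityʳ _) (trans (cong (_++ [ 𝟏 ]) (sym (replicate-∷ʳ j 𝟎))) (++-assoc (replicate j 𝟎) [ 𝟎 ] [ 𝟏 ]))

  -- The blocks 1 and 0^N differ in their first letter, so one common letter fixes the block, and a
  -- word ending inside 0^N is covered by the whole block. `n` is fuel, since a full block is
  -- removed at once.
  η-common : ∀ n {v₁ v₂ u₁ u₂ w} → length w ≤ n → IsImage (χ 0) v₁ u₁ → IsImage (χ 0) v₂ u₂ → w ≼ u₁ → w ≼ u₂ →
    ∃[ z ] z ≼ v₁ × z ≼ v₂ × w ⊑ concatMap (χ 0) z × length z ≤ length w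
  η-common n {w = []} w≤n im₁ im₂ p₁ p₂ = [] , [] , [] , [] , z≤n
  η-common (suc n) {v₁} {v₂} {w = c ∷ w} (s≤s w≤n) im₁ im₂ p₁ p₂
    with v₁ 0 in e₁ | v₂ 0 in e₂ | image-head im₁ | image-head im₂ | image-tail im₁ | image-tail im₂
  η-common (suc n) {w = c ∷ w} (s≤s w≤n) im₁ im₂ (x ∷ p₁) (y ∷ p₂) | 𝟎 | 𝟎 | x′ ∷ _ | _ | im₁′ | im₂′ =
    let z , q₁ , q₂ , w⊑ , z≤ = η-common n w≤n im₁′ im₂′ p₁ p₂ in
    𝟎 ∷ z , e₁ ∷ q₁ , e₂ ∷ q₂ , trans (sym x) x′ ∷ w⊑ , s≤s z≤
  η-common (suc n) {w = c ∷ w} (s≤s w≤n) im₁ im₂ (x ∷ p₁) (y ∷ p₂) | 𝟏 | 𝟏 | x′ ∷ h₁ | y′ ∷ h₂ | im₁′ | im₂′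
    with ≼-split (replicate M 𝟎) p₁ h₁
  ... | inj₁ w⊑ = [ 𝟏 ] , e₁ ∷ [] , e₂ ∷ [] , (trans (sym x) x′ ∷ (w⊑ ++ᵖ [])) , s≤s z≤n
  ... | inj₂ (r , refl , r≼) =
    let r≤w = length-++-≤ʳ′ (replicate M 𝟎) r
        z , q₁ , q₂ , w⊑ , z≤ = η-common n (≤-trans r≤w w≤n) im₁′ im₂′ r≼ (≼-++⁻ (replicate M 𝟎) p₂) in
    𝟏 ∷ z , e₁ ∷ q₁ , e₂ ∷ q₂ , trans (sym x) x′ ∷ ++-monoʳ-⊑ (replicate M 𝟎) w⊑ , s≤s (≤-trans z≤ r≤w)
    where
    length-++-≤ʳ′ : ∀ (v r : Word) → length r ≤ length (v ++ r)
    length-++-≤ʳ′ v r = subst (length r ≤_) (sym (length-++ v)) (m≤n+m (length r) (length v))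
  η-common (suc n) {w = c ∷ w} (s≤s w≤n) im₁ im₂ (x ∷ p₁) (y ∷ p₂) | 𝟎 | 𝟏 | x′ ∷ _ | y′ ∷ _ | im₁′ | im₂′ =
    𝟎≢𝟏 (trans (sym y) y′) (trans (sym x) x′)
  η-common (suc n) {w = c ∷ w} (s≤s w≤n) im₁ im₂ (x ∷ p₁) (y ∷ p₂) | 𝟏 | 𝟎 | x′ ∷ _ | y′ ∷ _ | im₁′ | im₂′ =
    𝟎≢𝟏 (trans (sym x) x′) (trans (sym y) y′)

  module _ {v u : Seq} (im : IsImage (χ 0) v u) where

    -- η(0) ends with 1 and η(1) with 0: left neighbours are exchanged but stay distinct.
    η-image-LeftSpecial : ∀ {w} → LeftSpecial v w → LeftSpecial u (concatMap (χ 0) w)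
    η-image-LeftSpecial {w} ls 𝟎 = Factor-++ (replicate M 𝟎) (subst (Factor u)
      (trans (cong (_++ concatMap (χ 0) w) (sym (replicate-∷ʳ M 𝟎))) (++-assoc (replicate M 𝟎) [ 𝟎 ] _))
      (image-Factor im (ls 𝟏)))
    η-image-LeftSpecial ls 𝟏 = image-Factor im (ls 𝟎)

    -- The factor 01 of `v` produces 1 0^N, in which 0^(N-1) occurs after the 1 and again after the
    -- first 0.
    η-replicate-LeftSpecial : Factor v (𝟎 ∷ 𝟏 ∷ []) → LeftSpecial u (replicate M 𝟎)
    η-replicate-LeftSpecial f 𝟎 = Factor-⊑ (⊑-++ (𝟎 ∷ replicate M 𝟎)) (Factor-++ [ 𝟏 ] (image-Factor im f))
    η-replicate-LeftSpecial f 𝟏 = Factor-⊑ (refl ∷ subst (replicate M 𝟎 ⊑_) (sym (++-identityʳ _))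
      (subst (replicate M 𝟎 ⊑_) (replicate-∷ʳ M 𝟎) (⊑-++ (replicate M 𝟎)))) (image-Factor im f)

    η-desubstitute-𝟏 : ∀ {w} → Factor u (𝟏 ∷ w) →
      ∃[ v′ ] v ⇝ v′ × v′ 0 ≡ 𝟎 × ∃[ u′ ] IsImage (χ 0) (tail v′) u′ × w ≼ u′
    η-desubstitute-𝟏 (z , u⇝z , p) with locate (χ≢[] 0) im u⇝z
    ... | located {v′} reach pre suf b split occ cont with v′ 0 in eq
    η-desubstitute-𝟏 (z , u⇝z , x ∷ p) | located {v′} reach [] [] 𝟏 refl (y ∷ occ) cont | 𝟎 =
      v′ , reach , eq , _ , cont , p
    η-desubstitute-𝟏 (z , u⇝z , x ∷ p) | located {v′} reach (_ ∷ []) suf b () occ cont | 𝟎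
    η-desubstitute-𝟏 (z , u⇝z , x ∷ p) | located {v′} reach (_ ∷ _ ∷ _) suf b () occ cont | 𝟎
    η-desubstitute-𝟏 (z , u⇝z , x ∷ p) | located {v′} reach pre suf b split (y ∷ occ) cont | 𝟏
      with refl , _ ← replicate-split (suc M) pre split = 𝟎≢𝟏 y x

    -- `m` is the number of zeros left in the block after the located 0; the word ends among them or
    -- continues into the next blocks.
    η-desubstitute-𝟎 : ∀ {w} → Factor u (𝟎 ∷ w) →
      ∃[ v′ ] v ⇝ v′ × v′ 0 ≡ 𝟏 × ∃[ u′ ] IsImage (χ 0) (tail v′) u′ ×
        ∃[ m ] m ≤ M × ((w ⊑ replicate m 𝟎) ⊎ (∃[ r ] w ≡ replicate m 𝟎 ++ r × r ≼ u′))
    η-desubstitute-𝟎 (z , u⇝z , p) with locate (χ≢[] 0) im u⇝z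
    ... | located {v′} reach pre suf b split occ cont with v′ 0 in eq
    η-desubstitute-𝟎 (z , u⇝z , x ∷ p) | located {v′} reach [] [] 𝟏 refl (y ∷ occ) cont | 𝟎 = 𝟎≢𝟏 x y
    η-desubstitute-𝟎 (z , u⇝z , x ∷ p) | located {v′} reach (_ ∷ []) suf b () occ cont | 𝟎
    η-desubstitute-𝟎 (z , u⇝z , x ∷ p) | located {v′} reach (_ ∷ _ ∷ _) suf b () occ cont | 𝟎
    η-desubstitute-𝟎 (z , u⇝z , x ∷ p) | located {v′} reach pre suf b split (y ∷ occ) cont | 𝟏
      with _ , e , s≤s m≤M ← replicate-split (suc M) pre split =
      v′ , reach , eq , _ , cont , length suf , m≤M ,
      subst (λ s → (_ ⊑ s) ⊎ (∃[ r ] _ ≡ s ++ r × r ≼ dropWord suf (tail z))) e (≼-split suf p occ)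

  replicate-≼-< : ∀ {m n u r} → m < n → replicate n 𝟎 ≼ u → ¬ replicate m 𝟎 ++ 𝟏 ∷ r ≼ u
  replicate-≼-< {zero}  (s≤s _) (x ∷ _) (y ∷ _) = 𝟎≢𝟏 x y
  replicate-≼-< {suc m} (s≤s h) (_ ∷ p) (_ ∷ q) = replicate-≼-< h p q

  -- Consider the occurrence after 0, with `m` < N zeros left in its block. If the word outlasts
  -- them, the next source letter is 0, since 11 is excluded, and the word starts with 0^m 1. The
  -- occurrence after 1 starts at a block boundary, where a run of zeros has length at least N;
  -- hence m = 0, both occurrences start at a boundary, and they can be decoded in parallel.
  η-LeftSpecial⁻ : ∀ {v u w} → IsImage (χ 0) v u → ¬ Factor v (𝟏 ∷ 𝟏 ∷ []) → LeftSpecial u w →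
    w ⊑ replicate M 𝟎 ⊎ (∃[ z ] LeftSpecial v z × w ⊑ concatMap (χ 0) z × length z ≤ length w)
  η-LeftSpecial⁻ im no𝟏𝟏 ls with η-desubstitute-𝟎 im (ls 𝟎) | η-desubstitute-𝟏 im (ls 𝟏)
  ... | _ , _ , _ , _ , _ , m , m≤M , inj₁ w⊑ | _ = inj₁ (⊑-trans w⊑ (Prefix.replicate⁺ m≤M refl))
  ... | _ , _ , _ , _ , _ , m , m≤M , inj₂ ([] , refl , _) | _ =
    inj₁ (subst (_⊑ _) (sym (++-identityʳ _)) (Prefix.replicate⁺ m≤M refl))
  ... | v₀ , r₀ , e₀ , u₀ , im₀ , m , m≤M , inj₂ (b ∷ r , refl , b∷r≼) | v₁ , r₁ , e₁ , u₁ , im₁ , p₁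
    with v₀ 1 in e | image-head im₀
  ... | 𝟏 | _ = contradiction (v₀ , r₀ , e₀ ∷ e ∷ []) no𝟏𝟏
  η-LeftSpecial⁻ {w = w} im no𝟏𝟏 ls | v₀ , r₀ , e₀ , u₀ , im₀ , zero , m≤M , inj₂ (b ∷ r , refl , b∷r≼) | v₁ , r₁ , e₁ , u₁ , im₁ , p₁
    | 𝟎 | _ =
    let z , q₀ , q₁ , w⊑ , z≤ = η-common (length w) ≤-refl im₀ im₁ b∷r≼ p₁ in
    inj₂ (z , (λ { 𝟏 → v₀ , r₀ , e₀ ∷ q₀ ; 𝟎 → v₁ , r₁ , e₁ ∷ q₁ }) , w⊑ , z≤)
  η-LeftSpecial⁻ im no𝟏𝟏 ls | v₀ , r₀ , e₀ , u₀ , im₀ , suc m , m≤M , inj₂ (𝟎 ∷ r , refl , y ∷ _) | v₁ , r₁ , e₁ , u₁ , im₁ , p₁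
    | 𝟎 | x ∷ _ = 𝟎≢𝟏 y x
  η-LeftSpecial⁻ im no𝟏𝟏 ls | v₀ , r₀ , e₀ , u₀ , im₀ , suc m , m≤M , inj₂ (𝟏 ∷ r , refl , _) | v₁ , r₁ , e₁ , u₁ , im₁ , p₁
    | 𝟎 | _ with v₁ 1 | image-head im₁
  η-LeftSpecial⁻ im no𝟏𝟏 ls | v₀ , r₀ , e₀ , u₀ , im₀ , suc m , m≤M , inj₂ (𝟏 ∷ r , refl , _) | v₁ , r₁ , e₁ , u₁ , im₁ , y ∷ p₁
    | 𝟎 | _ | 𝟎 | x ∷ _ = 𝟎≢𝟏 y x
  ... | 𝟏 | q = contradiction p₁ (replicate-≼-< (s≤s m≤M) q)

  -- The result of applying w ↦ φ(w) 0 to η(w) j times; each pass adds the 0 with which every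
  -- φ-image begins.
  f : ℕ → Word → Word
  f j w = concatMap (χ j) w ++ replicate j 𝟎

  φ∘f : ∀ j w → concatMap φ (f j w) ++ [ 𝟎 ] ≡ f (suc j) w
  φ∘f j w = begin
    concatMap φ (concatMap (χ j) w ++ replicate j 𝟎) ++ [ 𝟎 ]
      ≡⟨ cong (_++ [ 𝟎 ]) (concatMap-++ φ (concatMap (χ j) w) (replicate j 𝟎)) ⟩
    (concatMap φ (concatMap (χ j) w) ++ concatMap φ (replicate j 𝟎)) ++ [ 𝟎 ]
      ≡⟨ ++-assoc (concatMap φ (concatMap (χ j) w)) _ _ ⟩
    concatMap φ (concatMap (χ j) w) ++ (concatMap φ (replicate j 𝟎) ++ [ 𝟎 ])
      ≡⟨ cong₂ _++_ (trans (concatMap-concatMap φ (χ j) w) (concatMap-cong (φ∘χ j) w))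
                    (trans (cong (_++ [ 𝟎 ]) (φ-replicate j)) (replicate-∷ʳ j 𝟎)) ⟩
    f (suc j) w ∎
    where open ≡-Reasoning

  φ-f-replicate : ∀ n → concatMap φ (replicate n 𝟎) ++ [ 𝟎 ] ≡ replicate (suc n) 𝟎
  φ-f-replicate n = trans (cong (_++ [ 𝟎 ]) (φ-replicate n)) (replicate-∷ʳ n 𝟎)

  f-mono : ∀ j {w z} → w ⊑ z → f j w ⊑ f j z
  f-mono zero    {w} {z} p = subst₂ _⊑_ (sym (++-identityʳ _)) (sym (++-identityʳ _)) (concatMap-⊑ (χ 0) p)
  f-mono (suc j) {w} {z} p = subst₂ _⊑_ (φ∘f j w) (φ∘f j z) (φ𝟎-mono (f-mono j p))

  f-≼ : ∀ j {v u w} → IsImage (χ j) v u → w ≼ v → f j w ≼ u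
  f-≼ zero    {u = u} im p = subst (_≼ u) (sym (++-identityʳ _)) (im p)
  f-≼ (suc j) {v} {u} {w} im p = subst (_≼ u) (φ∘f j w) (φ-image-≼ (image-φ im) (f-≼ j (image-isImage j v) p))

  f-LeftSpecial : ∀ j {v u w} → IsImage (χ j) v u → LeftSpecial v w → LeftSpecial u (f j w)
  f-LeftSpecial zero {u = u} im ls = subst (LeftSpecial u) (sym (++-identityʳ _)) (η-image-LeftSpecial im ls)
  f-LeftSpecial (suc j) {v} {u} {w} im ls = subst (LeftSpecial u) (φ∘f j w)
    (φ-image-LeftSpecial (image-φ im) (f-LeftSpecial j (image-isImage j v) ls))

  -- The word 0^(N-1) created by η gains one 0 with each φ, because φ(0^n) 0 = 0^(n+1). For j = d_n
  -- this is the seed of a word T̂.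
  replicate-LeftSpecial : ∀ j {v u} → IsImage (χ j) v u → Factor v (𝟎 ∷ 𝟏 ∷ []) → LeftSpecial u (replicate (j + M) 𝟎)
  replicate-LeftSpecial zero    im p = η-replicate-LeftSpecial im p
  replicate-LeftSpecial (suc j) {v} {u} im p = subst (LeftSpecial u) (φ-f-replicate (j + M))
    (φ-image-LeftSpecial (image-φ im) (replicate-LeftSpecial j (image-isImage j v) p))

  f-LeftSpecial⁻ : ∀ j {v u w} → IsImage (χ j) v u → ¬ Factor v (𝟏 ∷ 𝟏 ∷ []) → LeftSpecial u w →
    w ⊑ replicate (j + M) 𝟎 ⊎ (∃[ z ] LeftSpecial v z × w ⊑ f j z × length z ≤ length w ∸ j)
  f-LeftSpecial⁻ zero im no𝟏𝟏 ls with η-LeftSpecial⁻ im no𝟏𝟏 ls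
  ... | inj₁ w⊑ = inj₁ w⊑
  ... | inj₂ (z , ls′ , w⊑ , z≤) = inj₂ (z , ls′ , w⊑ ++ᵖ [] , z≤)
  f-LeftSpecial⁻ (suc j) {w = []} im no𝟏𝟏 ls = inj₁ []
  f-LeftSpecial⁻ (suc j) {v} {u} {b ∷ w} im no𝟏𝟏 ls with φ-LeftSpecial⁻ (image-φ im) ls
  ... | y , ls′ , w⊑ , y≤ with f-LeftSpecial⁻ j (image-isImage j v) no𝟏𝟏 ls′
  ... | inj₁ y⊑ = inj₁ (subst (b ∷ w ⊑_) (φ-f-replicate (j + M)) (⊑-trans w⊑ (φ𝟎-mono y⊑)))
  ... | inj₂ (z , ls″ , y⊑ , z≤) = inj₂ (z , ls″ , subst (b ∷ w ⊑_) (φ∘f j z) (⊑-trans w⊑ (φ𝟎-mono y⊑)) , ≤-trans z≤ (∸-monoˡ-≤ j y≤))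

-- The left special factors of a dual sequence

swap : Letter → Letter
swap 𝟎 = 𝟏
swap 𝟏 = 𝟎

swap-involutive : ∀ a → swap (swap a) ≡ a
swap-involutive 𝟎 = refl
swap-involutive 𝟏 = refl

swap-injective : ∀ {a b} → swap a ≡ swap b → a ≡ b
swap-injective {a} {b} e = trans (sym (swap-involutive a)) (trans (cong swap e) (swap-involutive b))

map-swap-involutive : ∀ w → map swap (map swap w) ≡ w
map-swap-involutive []      = refl
map-swap-involutive (a ∷ w) = cong₂ _∷_ (swap-involutive a) (map-swap-involutive w)

module _ (τ : ℕ → Substitution) where

  compose-[] : ∀ n → compose τ n [] ≡ []
  compose-[] zero    = refl
  compose-[] (suc n) = compose-[] n

  compose-++ : ∀ n v w → compose τ n (v ++ w) ≡ compose τ n v ++ compose τ n w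
  compose-++ zero    v w = refl
  compose-++ (suc n) v w = trans (cong (compose τ n) (concatMap-++ (toList ∘ τ (suc n)) v w))
    (compose-++ n (applyʷ (τ (suc n)) v) (applyʷ (τ (suc n)) w))

  compose-replicate : ∀ n m a → compose τ n (replicate m a) ≡ compose τ n [ a ] ^ʷ m
  compose-replicate n zero    a = compose-[] n
  compose-replicate n (suc m) a = trans (compose-++ n [ a ] (replicate m a))
    (cong (compose τ n [ a ] ++_) (compose-replicate n m a))

length-^ʷ : ∀ w n → length (w ^ʷ n) ≡ n * length w
length-^ʷ w zero    = refl
length-^ʷ w (suc n) = trans (length-++ w) (cong (length w +_) (length-^ʷ w n))

-- Says that `s` is the longest common prefix of `u` and `t`, by exhibiting the two letters that
-- follow it; in this form it can be transported through morphisms.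
record Branching (u : Seq) (s t : Word) : Set where
  constructor branching
  field
    {a b} : Letter
    a≢b   : a ≢ b
    left  : s ++ [ a ] ≼ u
    right : s ++ [ b ] ⊑ t

-- The interface between the combinatorics of left special words and the counting, shared by ω and
-- its dual.
record Skeleton (u : Seq) (S T : ℕ → Word) : Set where
  field
    prefix-special : ∀ {w} → w ≼ u → LeftSpecial u w
    T-special      : ∀ k → LeftSpecial u (T k)
    special        : ∀ {w} → LeftSpecial u w → w ≼ u ⊎ ∃[ k ] w ⊑ T k
    S-zero         : length (S 0) ≡ 0
    S≼             : ∀ k → S k ≼ u
    S⊑T            : ∀ k → S k ⊑ T k
    T<S            : ∀ k → length (T k) < length (S (suc k))
    beyond         : ∀ k {w} → w ⊑ T k → length (S k) < length w → ¬ w ≼ u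

branching-≼ : ∀ {u s t} → Branching u s t → s ≼ u
branching-≼ br = ⊑-≼-trans (⊑-++ _) (Branching.left br)

branching-⊑ : ∀ {u s t} → Branching u s t → s ⊑ t
branching-⊑ br = ⊑-trans (⊑-++ _) (Branching.right br)

branching-beyond : ∀ {u s t w} → Branching u s t → w ⊑ t → length s < length w → ¬ w ≼ u
branching-beyond {s = s} (branching {a} {b} a≢b p q) w⊑t s<w w≼u =
  a≢b (last≡ s (≼-comparable p (⊑-≼-trans sb⊑w w≼u) (≤-reflexive (trans (length-∷ʳ a) (sym (length-∷ʳ b))))))
  where
  length-∷ʳ : ∀ a → length (s ++ [ a ]) ≡ suc (length s)
  length-∷ʳ a = trans (length-++ s) (+-comm _ 1)
  sb⊑w : s ++ [ b ] ⊑ _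
  sb⊑w = ⊑-comparable q w⊑t (≤-trans (≤-reflexive (length-∷ʳ b)) s<w)
  last≡ : ∀ s {a b : Letter} → s ++ [ a ] ⊑ s ++ [ b ] → a ≡ b
  last≡ []      (eq ∷ _) = eq
  last≡ (_ ∷ s) (_ ∷ p)  = last≡ s p

-- Left special words through all levels of a dual chain

module DualChain (M : ℕ) (1≤M : 1 ≤ M) (d : ℕ → ℕ) (M<d : ∀ k → M < d (suc k))
                 (X : ℕ → Seq) (im : ∀ k → IsImage (Dual.χ M (d (suc k))) (X (suc k)) (X k)) where
  open Dual M

  private
    N = suc M
    τ = σ̂ N d

  1≤d : ∀ k → 1 ≤ d (suc k)
  1≤d k = ≤-trans (s≤s z≤n) (M<d k)

  X-head : ∀ k → X k 0 ≡ 𝟎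
  X-head k with d (suc k) | 1≤d k | im k
  ... | suc j | _ | i = χ-image-head i

  X-no-𝟏𝟏 : ∀ k → ¬ Factor (X k) (𝟏 ∷ 𝟏 ∷ [])
  X-no-𝟏𝟏 k with d (suc k) | 1≤d k | im k
  ... | suc j | _ | i = χ-image-no-𝟏𝟏 i

  X-𝟎𝟏 : ∀ k → Factor (X k) (𝟎 ∷ 𝟏 ∷ [])
  X-𝟎𝟏 k with d (suc k) | 1≤d k | im k
  ... | suc j | _ | i = χ-image-𝟎𝟏 (X-head (suc k)) i

  X-[]-special : ∀ k → LeftSpecial (X k) []
  X-[]-special k 𝟎 = Factor-⊑ (refl ∷ []) (X-𝟎𝟏 k)
  X-[]-special k 𝟏 = Factor-++ [ 𝟎 ] (X-𝟎𝟏 k)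

  length-f-≥ : ∀ k w → suc (length w) ≤ length (f (d (suc k)) w)
  length-f-≥ k w = begin
    suc (length w)
      ≡⟨ +-comm 1 (length w) ⟩
    length w + 1
      ≤⟨ +-mono-≤ (length-concatMap-≥ (χ (d (suc k))) (χ-nonempty (d (suc k))) w) (1≤d k) ⟩
    length (concatMap (χ (d (suc k))) w) + d (suc k)
      ≡⟨ cong (length (concatMap (χ (d (suc k))) w) +_) (length-replicate (d (suc k))) ⟨
    length (concatMap (χ (d (suc k))) w) + length (replicate (d (suc k)) 𝟎)
      ≡⟨ length-++ (concatMap (χ (d (suc k))) w) ⟨
    length (f (d (suc k)) w) ∎
    where open ≤-Reasoning

  -- Induction on the length, for all levels at once: `f` adds at least one letter, so a prefix is
  -- covered by `f` of a prefix of the next level that is one letter shorter.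
  prefixes-special : ∀ n k {w} → length w ≤ n → w ≼ X k → LeftSpecial (X k) w
  prefixes-special n       k {[]}    _         p = X-[]-special k
  prefixes-special (suc n) k {a ∷ w} (s≤s w≤n) p = LeftSpecial-⊑ w⊑ (f-LeftSpecial (d (suc k)) (im k) y-special)
    where
    y = applyUpTo (X (suc k)) (length w)
    y≡ : length y ≡ length w
    y≡ = length-applyUpTo (X (suc k)) (length w)
    y-special = prefixes-special n (suc k) (subst (_≤ n) (sym y≡) w≤n) (applyUpTo-≼ (X (suc k)) (length w))
    w⊑ : a ∷ w ⊑ f (d (suc k)) y
    w⊑ = ≼-comparable p (f-≼ (d (suc k)) (im k) (applyUpTo-≼ (X (suc k)) (length w)))
           (subst (λ l → suc l ≤ length (f (d (suc k)) y)) y≡ (length-f-≥ k y))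

  -- The suffix Ŝ_k is what makes Φ k map left special words to left special words.
  Φ : ℕ → Word → Word
  Φ k w = compose τ k w ++ Ŝ N d k

  applyʷ-τ : ∀ n w → applyʷ (τ n) w ≡ concatMap (χ (d n)) w
  applyʷ-τ n = concatMap-cong (λ { 𝟎 → χˢ≗χ (d n) 𝟎 ; 𝟏 → χˢ≗χ (d n) 𝟏 })

  Φ-suc : ∀ k w → Φ (suc k) w ≡ Φ k (f (d (suc k)) w)
  Φ-suc k w = begin
    compose τ k (applyʷ (τ (suc k)) w) ++ compose τ k [ 𝟎 ] ^ʷ d (suc k) ++ Ŝ N d k
      ≡⟨ cong₂ (λ x y → x ++ y ++ Ŝ N d k) (cong (compose τ k) (applyʷ-τ (suc k) w)) (sym (compose-replicate τ k (d (suc k)) 𝟎)) ⟩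
    compose τ k (concatMap (χ (d (suc k))) w) ++ compose τ k (replicate (d (suc k)) 𝟎) ++ Ŝ N d k
      ≡⟨ ++-assoc (compose τ k (concatMap (χ (d (suc k))) w)) _ _ ⟨
    (compose τ k (concatMap (χ (d (suc k))) w) ++ compose τ k (replicate (d (suc k)) 𝟎)) ++ Ŝ N d k
      ≡⟨ cong (_++ Ŝ N d k) (compose-++ τ k (concatMap (χ (d (suc k))) w) _) ⟨
    Φ k (f (d (suc k)) w) ∎
    where open ≡-Reasoning

  Φ-Ŝ : ∀ k → Φ k (replicate (d (suc k)) 𝟎) ≡ Ŝ N d (suc k)
  Φ-Ŝ k = cong (_++ Ŝ N d k) (compose-replicate τ k (d (suc k)) 𝟎)

  Φ-T̂ : ∀ k → Φ k (replicate (d (suc k) + M) 𝟎) ≡ T̂ N d (suc k)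
  Φ-T̂ k = begin
    Φ k (replicate (d (suc k) + M) 𝟎)
      ≡⟨ cong (Φ k) (trans (cong (λ n → replicate n 𝟎) (+-comm (d (suc k)) M)) (sym (replicate-++ M (d (suc k)) 𝟎))) ⟩
    Φ k (replicate M 𝟎 ++ replicate (d (suc k)) 𝟎)
      ≡⟨ cong (_++ Ŝ N d k) (compose-++ τ k (replicate M 𝟎) _) ⟩
    (compose τ k (replicate M 𝟎) ++ compose τ k (replicate (d (suc k)) 𝟎)) ++ Ŝ N d k
      ≡⟨ ++-assoc (compose τ k (replicate M 𝟎)) _ _ ⟩
    compose τ k (replicate M 𝟎) ++ Φ k (replicate (d (suc k)) 𝟎)
      ≡⟨ cong₂ _++_ (compose-replicate τ k M 𝟎) (Φ-Ŝ k) ⟩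
    T̂ N d (suc k) ∎
    where open ≡-Reasoning

  Φ-≼ : ∀ k {w} → w ≼ X k → Φ k w ≼ X 0
  Φ-≼ zero    p = subst (_≼ X 0) (sym (++-identityʳ _)) p
  Φ-≼ (suc k) {w} p = subst (_≼ X 0) (sym (Φ-suc k w)) (Φ-≼ k (f-≼ (d (suc k)) (im k) p))

  Φ-LeftSpecial : ∀ k {w} → LeftSpecial (X k) w → LeftSpecial (X 0) (Φ k w)
  Φ-LeftSpecial zero    ls = subst (LeftSpecial (X 0)) (sym (++-identityʳ _)) ls
  Φ-LeftSpecial (suc k) {w} ls = subst (LeftSpecial (X 0)) (sym (Φ-suc k w)) (Φ-LeftSpecial k (f-LeftSpecial (d (suc k)) (im k) ls))

  Φ-mono : ∀ k {w z} → w ⊑ z → Φ k w ⊑ Φ k z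
  Φ-mono zero    p = subst₂ _⊑_ (sym (++-identityʳ _)) (sym (++-identityʳ _)) p
  Φ-mono (suc k) {w} {z} p = subst₂ _⊑_ (sym (Φ-suc k w)) (sym (Φ-suc k z)) (Φ-mono k (f-mono (d (suc k)) p))

  -- The letter after χ_j(w) 0^j reveals the next source letter: 0 contributes 0^j 1, while 1
  -- contributes 0^N, so that with the final 0^j at least j + 1 zeros follow.
  f-∷ʳ : ∀ j w a → f j w ++ [ swap a ] ⊑ f j (w ++ [ a ])
  f-∷ʳ j w a = subst₂ _⊑_ (sym (++-assoc (concatMap (χ j) w) (replicate j 𝟎) [ swap a ]))
    (trans (sym (++-assoc (concatMap (χ j) w) _ _)) (cong (_++ replicate j 𝟎) (sym (concatMap-++ (χ j) w [ a ]))))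
    (++-monoʳ-⊑ (concatMap (χ j) w) (go a))
    where
    go : ∀ a → replicate j 𝟎 ++ [ swap a ] ⊑ concatMap (χ j) [ a ] ++ replicate j 𝟎
    go 𝟎 = (⊑-refl ++ᵖ []) ++ᵖ replicate j 𝟎
    go 𝟏 = subst₂ _⊑_ (sym (replicate-∷ʳ j 𝟎))
      (trans (sym (replicate-++ N j 𝟎)) (cong (_++ replicate j 𝟎) (sym (++-identityʳ (replicate N 𝟎)))))
      (Prefix.replicate⁺ (s≤s (m≤n+m j M)) refl)

  Φ-branching : ∀ k {s t} → Branching (X k) s t → Branching (X 0) (Φ k s) (Φ k t)
  Φ-branching zero    {s} {t} br = subst₂ (Branching (X 0)) (sym (++-identityʳ s)) (sym (++-identityʳ t)) br
  Φ-branching (suc k) {s} {t} (branching {a} {b} a≢b p q) =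
    subst₂ (Branching (X 0)) (sym (Φ-suc k s)) (sym (Φ-suc k t)) (Φ-branching k
      (branching (a≢b ∘ swap-injective)
        (⊑-≼-trans (f-∷ʳ (d (suc k)) s a) (f-≼ (d (suc k)) (im k) p))
        (⊑-trans (f-∷ʳ (d (suc k)) s b) (f-mono (d (suc k)) q))))

  -- At level k the sequence begins with 0^d 1, while 0^(d+N-1) has another 0 after 0^d because N ≥
  -- 2; `Φ k` carries this branching down to level 0.
  Ŝ-T̂-branching : ∀ k → Branching (X 0) (Ŝ N d (suc k)) (T̂ N d (suc k))
  Ŝ-T̂-branching k = subst₂ (Branching (X 0)) (Φ-Ŝ k) (Φ-T̂ k) (Φ-branching k
    (branching {a = 𝟏} {b = 𝟎} (λ ())
      (⊑-≼-trans (subst (replicate (d (suc k)) 𝟎 ++ [ 𝟏 ] ⊑_) (sym (++-identityʳ _)) ⊑-refl) (im k (X-head (suc k) ∷ [])))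
      (subst (_⊑ replicate (d (suc k) + M) 𝟎) (sym (replicate-∷ʳ (d (suc k)) 𝟎))
        (Prefix.replicate⁺ (subst (_≤ d (suc k) + M) (+-comm (d (suc k)) 1) (+-monoʳ-≤ (d (suc k)) 1≤M)) refl))))

  T̂-special : ∀ k → LeftSpecial (X 0) (T̂ N d (suc k))
  T̂-special k = subst (LeftSpecial (X 0)) (Φ-T̂ k)
    (Φ-LeftSpecial k (replicate-LeftSpecial (d (suc k)) (im k) (X-𝟎𝟏 (suc k))))

  -- Pulling back stops where a level meets a prefix of 0^(d+N-1), which makes `w` a prefix of some
  -- T̂; otherwise every level passed costs at least one letter.
  special-descent : ∀ k {w} → LeftSpecial (X 0) w →
    (∃[ i ] w ⊑ T̂ N d (suc i)) ⊎ (∃[ z ] LeftSpecial (X k) z × w ⊑ Φ k z × length z ≤ length w ∸ k)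
  special-descent zero {w} ls = inj₂ (w , ls , ⊑-++ w , ≤-refl)
  special-descent (suc k) {w} ls with special-descent k ls
  ... | inj₁ done = inj₁ done
  ... | inj₂ (z , ls′ , w⊑ , z≤) with f-LeftSpecial⁻ (d (suc k)) (im k) (X-no-𝟏𝟏 (suc k)) ls′
  ... | inj₁ z⊑ = inj₁ (k , subst (w ⊑_) (Φ-T̂ k) (⊑-trans w⊑ (Φ-mono k z⊑)))
  ... | inj₂ (y , ls″ , z⊑ , y≤) = inj₂ (y , ls″ , subst (w ⊑_) (sym (Φ-suc k y)) (⊑-trans w⊑ (Φ-mono k z⊑)) , y≤′)
    where
    y≤′ : length y ≤ length w ∸ suc k
    y≤′ = begin
      length y                 ≤⟨ y≤ ⟩
      length z ∸ d (suc k)     ≤⟨ ∸-monoʳ-≤ (length z) (1≤d k) ⟩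
      length z ∸ 1             ≤⟨ ∸-monoˡ-≤ 1 z≤ ⟩
      length w ∸ k ∸ 1         ≡⟨ ∸-+-assoc (length w) k 1 ⟩
      length w ∸ (k + 1)       ≡⟨ cong (length w ∸_) (+-comm k 1) ⟩
      length w ∸ suc k         ∎
      where open ≤-Reasoning

  special : ∀ {w} → LeftSpecial (X 0) w → w ≼ X 0 ⊎ ∃[ i ] w ⊑ T̂ N d (suc i)
  -- After `length w` levels nothing is left of the word, and `Φ` of the empty word is a prefix of
  -- `X 0`.
  special {w} ls with special-descent (length w) ls
  ... | inj₁ done = inj₂ done
  ... | inj₂ ([]    , _ , w⊑ , _) = inj₁ (⊑-≼-trans w⊑ (Φ-≼ (length w) []))
  ... | inj₂ (_ ∷ y , _ , _ , z≤) with () ← subst (suc (length y) ≤_) (n∸n≡0 (length w)) z≤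

  -- Lengths of the dual words and their closed forms

  ∣Σ̂∣ : ℕ → ℕ
  ∣Σ̂∣ k = length (Σ̂ʷ N d (suc k))

  ∣Σ̂∣-one : ∣Σ̂∣ 1 ≡ d 1 + 1
  ∣Σ̂∣-one = trans (cong length (trans (applyʷ-τ 1 [ 𝟎 ]) (++-identityʳ _)))
    (trans (length-++ (replicate (d 1) 𝟎)) (cong (_+ 1) (length-replicate (d 1))))

  ∣Σ̂∣-suc-suc : ∀ k → ∣Σ̂∣ (suc (suc k)) ≡ d (suc (suc k)) * ∣Σ̂∣ (suc k) + N * ∣Σ̂∣ k
  ∣Σ̂∣-suc-suc k = begin
    length (compose τ (suc k) (applyʷ (τ (suc (suc k))) [ 𝟎 ]))
      ≡⟨ cong (length ∘ compose τ (suc k)) (trans (applyʷ-τ (suc (suc k)) [ 𝟎 ]) (++-identityʳ _)) ⟩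
    length (compose τ (suc k) (replicate e 𝟎 ++ [ 𝟏 ]))
      ≡⟨ cong length (compose-++ τ (suc k) (replicate e 𝟎) [ 𝟏 ]) ⟩
    length (compose τ (suc k) (replicate e 𝟎) ++ compose τ k (applyʷ (τ (suc k)) [ 𝟏 ]))
      ≡⟨ length-++ (compose τ (suc k) (replicate e 𝟎)) ⟩
    length (compose τ (suc k) (replicate e 𝟎)) + length (compose τ k (applyʷ (τ (suc k)) [ 𝟏 ]))
      ≡⟨ cong₂ (λ x y → length x + length (compose τ k y))
               (compose-replicate τ (suc k) e 𝟎) (trans (applyʷ-τ (suc k) [ 𝟏 ]) (++-identityʳ _)) ⟩
    length (compose τ (suc k) [ 𝟎 ] ^ʷ e) + length (compose τ k (replicate N 𝟎))
      ≡⟨ cong₂ _+_ (length-^ʷ (compose τ (suc k) [ 𝟎 ]) e)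
           (trans (cong length (compose-replicate τ k N 𝟎)) (length-^ʷ (compose τ k [ 𝟎 ]) N)) ⟩
    e * ∣Σ̂∣ (suc k) + N * ∣Σ̂∣ k ∎
    where
    open ≡-Reasoning
    e = d (suc (suc k))

  ∣Σ̂∣-mono : ∀ k → ∣Σ̂∣ k ≤ ∣Σ̂∣ (suc k)
  ∣Σ̂∣-mono zero    = subst (1 ≤_) (sym ∣Σ̂∣-one) (m≤n+m 1 (d 1))
  ∣Σ̂∣-mono (suc k) = subst (∣Σ̂∣ (suc k) ≤_) (sym (∣Σ̂∣-suc-suc k))
    (≤-trans (≤-trans (≤-reflexive (sym (*-identityˡ (∣Σ̂∣ (suc k))))) (*-monoˡ-≤ (∣Σ̂∣ (suc k)) (1≤d (suc k)))) (m≤m+n _ _))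

  1≤∣Σ̂∣ : ∀ k → 1 ≤ ∣Σ̂∣ k
  1≤∣Σ̂∣ zero    = ≤-refl
  1≤∣Σ̂∣ (suc k) = ≤-trans (1≤∣Σ̂∣ k) (∣Σ̂∣-mono k)

  ŝ-suc : ∀ k → ŝ N d (suc k) ≡ d (suc k) * ∣Σ̂∣ k + ŝ N d k
  ŝ-suc k = trans (length-++ (Σ̂ʷ N d (suc k) ^ʷ d (suc k)))
    (cong (_+ ŝ N d k) (length-^ʷ (Σ̂ʷ N d (suc k)) (d (suc k))))

  t̂-suc : ∀ k → t̂ N d (suc k) ≡ M * ∣Σ̂∣ k + ŝ N d (suc k)
  t̂-suc k = trans (length-++ (Σ̂ʷ N d (suc k) ^ʷ M))
    (cong (_+ ŝ N d (suc k)) (length-^ʷ (Σ̂ʷ N d (suc k)) M))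

  -- The N - 1 extra copies of one Σ̂ in T̂ are outweighed by the d ≥ N copies of the next Σ̂, which
  -- is at least as long. Here the full digit bound matters, not only d ≥ 1.
  T̂<Ŝ : ∀ k → t̂ N d k < ŝ N d (suc k)
  T̂<Ŝ zero    = subst (0 <_) (sym (ŝ-suc 0)) (≤-trans (*-mono-≤ (1≤d 0) (≤-refl {1})) (m≤m+n _ _))
  T̂<Ŝ (suc k) = subst₂ _<_ (sym (t̂-suc k)) (sym (ŝ-suc (suc k)))
    (+-monoˡ-< (ŝ N d (suc k)) (begin-strict
      M * ∣Σ̂∣ k                      ≤⟨ *-monoʳ-≤ M (∣Σ̂∣-mono k) ⟩
      M * ∣Σ̂∣ (suc k)                <⟨ +-monoˡ-< (M * ∣Σ̂∣ (suc k)) (1≤∣Σ̂∣ (suc k)) ⟩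
      N * ∣Σ̂∣ (suc k)                ≤⟨ *-monoˡ-≤ (∣Σ̂∣ (suc k)) (M<d (suc k)) ⟩
      d (suc (suc k)) * ∣Σ̂∣ (suc k)  ∎))
    where open ≤-Reasoning

  private
    -- This is p_k / N, given by its own recurrence so that the division is evaluated only once, on
    -- an explicit multiple of N.
    r : ℕ → ℕ
    r 0             = 0
    r 1             = 1
    r (suc (suc k)) = d (suc (suc k)) * r (suc k) + N * r k

    num≡r*N : ∀ k → num N d (suc k) ≡ r k * N
    num≡r*N 0             = refl
    num≡r*N 1             = trans (cong (_+ N * 1) (*-zeroʳ (d 1))) (*-comm N 1)
    num≡r*N (suc (suc k)) = trans (cong₂ (λ x y → d (suc (suc k)) * x + N * y) (num≡r*N (suc k)) (num≡r*N k))
      (rearrange (d (suc (suc k))) (r (suc k)) (r k) N)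
      where
      rearrange : ∀ e x y n → e * (x * n) + n * (y * n) ≡ (e * x + n * y) * n
      rearrange = solve-∀

    ∣Σ̂∣≡r+den : ∀ k → ∣Σ̂∣ k ≡ r k + den N d (suc k)
    ∣Σ̂∣≡r+den 0 = refl
    ∣Σ̂∣≡r+den 1 = trans ∣Σ̂∣-one (rearrange (d 1) N)
      where
      rearrange : ∀ e n → e + 1 ≡ 1 + (e * 1 + n * 0)
      rearrange = solve-∀
    ∣Σ̂∣≡r+den (suc (suc k)) = trans (∣Σ̂∣-suc-suc k)
      (trans (cong₂ (λ x y → d (suc (suc k)) * x + N * y) (∣Σ̂∣≡r+den (suc k)) (∣Σ̂∣≡r+den k))
        (rearrange (d (suc (suc k))) (r (suc k)) (r k) (den N d (suc (suc k))) (den N d (suc k)) N))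
      where
      rearrange : ∀ e x y x′ y′ n → e * (x + x′) + n * (y + y′) ≡ (e * x + n * y) + (e * x′ + n * y′)
      rearrange = solve-∀

  ∣Σ̂∣-formula : ∀ k → ∣Σ̂∣ k ≡ num N d (suc k) / N + den N d (suc k)
  ∣Σ̂∣-formula k = trans (∣Σ̂∣≡r+den k) (cong (_+ den N d (suc k))
    (sym (trans (cong (_/ N) (num≡r*N k)) (m*n/n≡m (r k) N))))

  skeleton : Skeleton (X 0) (Ŝ N d) (T̂ N d)
  skeleton = record
    { prefix-special = λ {w} → prefixes-special (length w) 0 ≤-refl
    ; T-special      = λ { zero → X-[]-special 0 ; (suc k) → T̂-special k }
    ; special        = λ ls → map₂ (λ (i , p) → suc i , p) (special ls)
    ; S-zero         = refl
    ; S≼             = λ { zero → [] ; (suc k) → branching-≼ (Ŝ-T̂-branching k) }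
    ; S⊑T            = λ { zero → [] ; (suc k) → branching-⊑ (Ŝ-T̂-branching k) }
    ; T<S            = T̂<Ŝ
    ; beyond         = λ { zero [] () ; (suc k) → branching-beyond (Ŝ-T̂-branching k) }
    }

-- The left special factors of an NCF sequence

map-⊑ : ∀ (h : Letter → Letter) {w z} → w ⊑ z → map h w ⊑ map h z
map-⊑ h []         = []
map-⊑ h (refl ∷ p) = refl ∷ map-⊑ h p

map-≼ : ∀ (h : Letter → Letter) {w u} → w ≼ u → map h w ≼ h ∘ u
map-≼ h []      = []
map-≼ h (x ∷ p) = cong h x ∷ map-≼ h p

≼-unswap : ∀ {w u} → w ≼ swap ∘ u → map swap w ≼ u
≼-unswap {u = u} p = ≼-resp-≗ (swap-involutive ∘ u) (map-≼ swap p)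

Factor-swap : ∀ {u w} → Factor u w → Factor (swap ∘ u) (map swap w)
Factor-swap {u} (_ , here , p) = swap ∘ u , here , map-≼ swap p
Factor-swap (v , skip r , p)   = let v′ , r′ , p′ = Factor-swap (v , r , p) in v′ , skip r′ , p′

Factor-unswap : ∀ {u w} → Factor (swap ∘ u) w → Factor u (map swap w)
Factor-unswap {u} (_ , here , p) = u , here , ≼-unswap p
Factor-unswap {u} (v , skip r , p) = let v′ , r′ , p′ = Factor-unswap {tail u} (v , r , p) in v′ , skip r′ , p′

LeftSpecial-swap : ∀ {u w} → LeftSpecial u w → LeftSpecial (swap ∘ u) (map swap w)
LeftSpecial-swap {u} {w} ls a =
  subst (λ b → Factor (swap ∘ u) (b ∷ map swap w)) (swap-involutive a) (Factor-swap (ls (swap a)))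

LeftSpecial-unswap : ∀ {u w} → LeftSpecial (swap ∘ u) w → LeftSpecial u (map swap w)
LeftSpecial-unswap {u} {w} ls a =
  subst (λ b → Factor u (b ∷ map swap w)) (swap-involutive a) (Factor-unswap (ls (swap a)))

module Primal (M : ℕ) where
  open Dual M

  private
    N = suc M

  -- Explicitly 0 ↦ 0 and 1 ↦ 1^N. Written through η so that the results on η carry over by
  -- exchanging letters.
  ψ : Morphism
  ψ a = map swap (χ 0 a)

  -- σ_n = ψ ∘ θ and σ̂_n = θ ∘ ψ, where θ : 0 ↦ 0^{d_n} 1, 1 ↦ 0 is χ for N = 1.
  θ : ℕ → Morphism
  θ = Dual.χ 0

  concatMap-ψ : ∀ w → concatMap ψ w ≡ map swap (concatMap (χ 0) w)
  concatMap-ψ w = sym (map-concatMap swap (χ 0) w)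

  concatMap-replicate-[] : ∀ (h : Morphism) n a b → h a ≡ [ b ] → concatMap h (replicate n a) ≡ replicate n b
  concatMap-replicate-[] h zero    a b e = refl
  concatMap-replicate-[] h (suc n) a b e = cong₂ _++_ e (concatMap-replicate-[] h n a b e)

  toList-replicate-++⁺ : ∀ j (xs : List⁺ Letter) → toList (replicate j 𝟎 ++⁺ xs) ≡ replicate j 𝟎 ++ toList xs
  toList-replicate-++⁺ zero    xs = refl
  toList-replicate-++⁺ (suc j) xs = cong (𝟎 ∷_) (toList-replicate-++⁺ j xs)

  ψ∘θ : ∀ d n a → concatMap ψ (θ (d n) a) ≡ toList (σ N d n a)
  ψ∘θ d n 𝟎 = begin
    concatMap ψ (replicate (d n) 𝟎 ++ [ 𝟏 ])
      ≡⟨ concatMap-++ ψ (replicate (d n) 𝟎) [ 𝟏 ] ⟩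
    concatMap ψ (replicate (d n) 𝟎) ++ concatMap ψ [ 𝟏 ]
      ≡⟨ cong₂ _++_ (concatMap-replicate-[] ψ (d n) 𝟎 𝟎 refl) (trans (++-identityʳ _) (map-replicate swap N 𝟎)) ⟩
    replicate (d n) 𝟎 ++ replicate N 𝟏
      ≡⟨ toList-replicate-++⁺ (d n) _ ⟨
    toList (σ N d n 𝟎) ∎
    where open ≡-Reasoning
  ψ∘θ d n 𝟏 = refl

  θ∘ψ : ∀ j a → concatMap (θ j) (ψ a) ≡ χ j a
  θ∘ψ j 𝟎 = ++-identityʳ _
  θ∘ψ j 𝟏 = trans (cong (concatMap (θ j)) (map-replicate swap N 𝟎)) (concatMap-replicate-[] (θ j) N 𝟏 𝟎 refl)

  ψ-∷ʳ : ∀ w a → concatMap ψ w ++ [ a ] ⊑ concatMap ψ (w ++ [ a ])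
  ψ-∷ʳ w a = subst (concatMap ψ w ++ [ a ] ⊑_) (sym (concatMap-++ ψ w [ a ])) (++-monoʳ-⊑ (concatMap ψ w) (begins a))
    where
    begins : ∀ a → [ a ] ⊑ concatMap ψ [ a ]
    begins 𝟎 = refl ∷ []
    begins 𝟏 = refl ∷ []

  -- ψ(a) begins with a, so the images of `s` and `t` part at the same two letters.
  ψ-branching : ∀ {v u s t} → IsImage ψ v u → Branching v s t → Branching u (concatMap ψ s) (concatMap ψ t)
  ψ-branching {s = s} im (branching {a} {b} a≢b p q) =
    branching a≢b (⊑-≼-trans (ψ-∷ʳ s a) (im p)) (⊑-trans (ψ-∷ʳ s b) (concatMap-⊑ ψ q))

  ψ-image-swap : ∀ {v u} → IsImage ψ v u → IsImage (χ 0) v (swap ∘ u)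
  ψ-image-swap {u = u} im {w} p = subst (_≼ swap ∘ u)
    (trans (cong (map swap) (concatMap-ψ w)) (map-swap-involutive _)) (map-≼ swap (im p))

  ψ-nonempty : ∀ a → 1 ≤ length (ψ a)
  ψ-nonempty 𝟎 = ≤-refl
  ψ-nonempty 𝟏 = s≤s z≤n

  ψ-LeftSpecial : ∀ {v u w} → IsImage ψ v u → LeftSpecial v w → LeftSpecial u (concatMap ψ w)
  ψ-LeftSpecial {u = u} {w} im ls = subst (LeftSpecial u) (sym (concatMap-ψ w))
    (LeftSpecial-unswap (η-image-LeftSpecial (ψ-image-swap im) ls))

  module Words (d : ℕ → ℕ) where

    -- Regrouping: (ψθ₁)⋯(ψθ_k)ψ = ψ(θ₁ψ)⋯(θ_kψ).
    compose-ψ : ∀ k w → compose (σ N d) k (concatMap ψ w) ≡ concatMap ψ (compose (σ̂ N d) k w)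
    compose-ψ zero    w = refl
    compose-ψ (suc k) w = begin
      compose (σ N d) k (applyʷ (σ N d (suc k)) (concatMap ψ w))
        ≡⟨ cong (compose (σ N d) k) (concatMap-cong (sym ∘ ψ∘θ d (suc k)) (concatMap ψ w)) ⟩
      compose (σ N d) k (concatMap (concatMap ψ ∘ θ e) (concatMap ψ w))
        ≡⟨ cong (compose (σ N d) k) (concatMap-concatMap ψ (θ e) (concatMap ψ w)) ⟨
      compose (σ N d) k (concatMap ψ (concatMap (θ e) (concatMap ψ w)))
        ≡⟨ cong (compose (σ N d) k ∘ concatMap ψ)
             (trans (concatMap-concatMap (θ e) ψ w) (concatMap-cong (λ a → trans (θ∘ψ e a) (σ̂≗χ a)) w)) ⟩
      compose (σ N d) k (concatMap ψ (applyʷ (σ̂ N d (suc k)) w))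
        ≡⟨ compose-ψ k (applyʷ (σ̂ N d (suc k)) w) ⟩
      concatMap ψ (compose (σ̂ N d) (suc k) w) ∎
      where
      open ≡-Reasoning
      e = d (suc k)
      σ̂≗χ : ∀ a → χ e a ≡ toList (σ̂ N d (suc k) a)
      σ̂≗χ 𝟎 = sym (χˢ≗χ e 𝟎)
      σ̂≗χ 𝟏 = refl

    -- σ_{k+1}(1) = 0 = ψ(0), so Σ_{k+1} is σ₁⋯σ_k applied to ψ(0).
    Σʷ-ψ : ∀ k → Σʷ N d (suc k) ≡ concatMap ψ (Σ̂ʷ N d (suc k))
    Σʷ-ψ k = compose-ψ k [ 𝟎 ]

    ^ʷ-ψ : ∀ w n → concatMap ψ (w ^ʷ n) ≡ concatMap ψ w ^ʷ n
    ^ʷ-ψ w zero    = refl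
    ^ʷ-ψ w (suc n) = trans (concatMap-++ ψ w (w ^ʷ n)) (cong (concatMap ψ w ++_) (^ʷ-ψ w n))

    Σʷ^-ψ : ∀ k n → Σʷ N d (suc k) ^ʷ n ≡ concatMap ψ (Σ̂ʷ N d (suc k) ^ʷ n)
    Σʷ^-ψ k n = trans (cong (_^ʷ n) (Σʷ-ψ k)) (sym (^ʷ-ψ (Σ̂ʷ N d (suc k)) n))

    S-ψ : ∀ k → S N d k ≡ concatMap ψ (Ŝ N d k)
    S-ψ zero    = refl
    S-ψ (suc k) = trans (cong₂ _++_ (Σʷ^-ψ k (d (suc k))) (S-ψ k)) (sym (concatMap-++ ψ (Σ̂ʷ N d (suc k) ^ʷ d (suc k)) (Ŝ N d k)))

    T-ψ : ∀ k → T N d (suc k) ≡ concatMap ψ (T̂ N d (suc k))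
    T-ψ k = trans (cong₂ _++_ (Σʷ^-ψ k M) (S-ψ (suc k))) (sym (concatMap-++ ψ (Σ̂ʷ N d (suc k) ^ʷ M) (Ŝ N d (suc k))))

    T-zero : T N d 0 ≡ replicate M 𝟏
    T-zero = go M
      where
      go : ∀ n → [ 𝟏 ] ^ʷ n ≡ replicate n 𝟏
      go zero    = refl
      go (suc n) = cong (𝟏 ∷_) (go n)

    ∣Σ∣ : ℕ → ℕ
    ∣Σ∣ k = length (Σʷ N d k)

    ∣Σ∣-formula : ∀ k → ∣Σ∣ k ≡ num N d k + den N d k
    ∣Σ∣-formula 0 = refl
    ∣Σ∣-formula 1 = refl
    ∣Σ∣-formula (suc (suc k)) = begin
      length (compose (σ N d) k (applyʷ (σ N d (suc k)) [ 𝟎 ]))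
        ≡⟨ cong (length ∘ compose (σ N d) k) (trans (++-identityʳ _) (toList-replicate-++⁺ e _)) ⟩
      length (compose (σ N d) k (replicate e 𝟎 ++ replicate N 𝟏))
        ≡⟨ cong length (trans (compose-++ (σ N d) k (replicate e 𝟎) (replicate N 𝟏))
             (cong₂ _++_ (compose-replicate (σ N d) k e 𝟎) (compose-replicate (σ N d) k N 𝟏))) ⟩
      length (Σʷ N d (suc k) ^ʷ e ++ Σʷ N d k ^ʷ N)
        ≡⟨ trans (length-++ (Σʷ N d (suc k) ^ʷ e)) (cong₂ _+_ (length-^ʷ (Σʷ N d (suc k)) e) (length-^ʷ (Σʷ N d k) N)) ⟩
      e * ∣Σ∣ (suc k) + N * ∣Σ∣ k
        ≡⟨ cong₂ (λ x z → e * x + N * z) (∣Σ∣-formula (suc k)) (∣Σ∣-formula k) ⟩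
      e * (num N d (suc k) + den N d (suc k)) + N * (num N d k + den N d k)
        ≡⟨ rearrange e (num N d (suc k)) (num N d k) (den N d (suc k)) (den N d k) N ⟩
      num N d (suc (suc k)) + den N d (suc (suc k)) ∎
      where
      open ≡-Reasoning
      e = d (suc k)
      rearrange : ∀ e x y x′ y′ n → e * (x + x′) + n * (y + y′) ≡ (e * x + n * y) + (e * x′ + n * y′)
      rearrange = solve-∀

    ∣Σ∣-suc-suc : ∀ k → ∣Σ∣ (suc (suc k)) ≡ d (suc k) * ∣Σ∣ (suc k) + N * ∣Σ∣ k
    ∣Σ∣-suc-suc k = begin
      ∣Σ∣ (suc (suc k)) ≡⟨ ∣Σ∣-formula (suc (suc k)) ⟩
      (e * num N d (suc k) + N * num N d k) + (e * den N d (suc k) + N * den N d k)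
        ≡⟨ rearrange e (num N d (suc k)) (num N d k) (den N d (suc k)) (den N d k) N ⟩
      e * (num N d (suc k) + den N d (suc k)) + N * (num N d k + den N d k)
        ≡⟨ cong₂ (λ x z → e * x + N * z) (∣Σ∣-formula (suc k)) (∣Σ∣-formula k) ⟨
      e * ∣Σ∣ (suc k) + N * ∣Σ∣ k ∎
      where
      open ≡-Reasoning
      e = d (suc k)
      rearrange : ∀ e x y x′ y′ n → (e * x + n * y) + (e * x′ + n * y′) ≡ e * (x + x′) + n * (y + y′)
      rearrange = solve-∀

    s-suc : ∀ k → s N d (suc k) ≡ d (suc k) * ∣Σ∣ (suc k) + s N d k
    s-suc k = trans (length-++ (Σʷ N d (suc k) ^ʷ d (suc k)))
      (cong (_+ s N d k) (length-^ʷ (Σʷ N d (suc k)) (d (suc k))))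

    t-formula : ∀ k → t N d k ≡ M * ∣Σ∣ k + s N d k
    t-formula zero    = trans (length-^ʷ [ 𝟏 ] M) (sym (+-identityʳ (M * 1)))
    t-formula (suc k) = trans (length-++ (Σʷ N d (suc k) ^ʷ M))
      (cong (_+ s N d (suc k)) (length-^ʷ (Σʷ N d (suc k)) M))

  module PrimalChain (1≤M : 1 ≤ M) (d : ℕ → ℕ) (M<d : ∀ k → M < d (suc k)) (W : ℕ → Seq)
                     (im : ∀ k → IsImage (toList ∘ σ N d (suc k)) (W (suc k)) (W k)) where

    open Words d

    -- The sequences halfway through each level: `W k` = ψ(`V k`) and `V k` = θψ(`V (suc k)`), so
    -- `V` is a chain for the dual substitutions.
    V : ℕ → Seq
    V k = Dual.image 0 (d (suc k)) (W (suc k))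

    V-image : ∀ k → IsImage (θ (d (suc k))) (W (suc k)) (V k)
    V-image k = Dual.image-isImage 0 (d (suc k)) (W (suc k))

    W-ψ-image : ∀ k → IsImage ψ (V k) (W k)
    W-ψ-image k = image-factor (Dual.χ-nonempty 0 (d (suc k))) (ψ∘θ d (suc k)) (V-image k) (im k)

    V-χ-image : ∀ k → IsImage (χ (d (suc k))) (V (suc k)) (V k)
    V-χ-image k = image-cong (θ∘ψ (d (suc k))) (image-∘ (W-ψ-image (suc k)) (V-image k))

    open DualChain M 1≤M d M<d V V-χ-image using (X-head; X-𝟎𝟏; X-no-𝟏𝟏; Ŝ-T̂-branching; 1≤d) renaming (skeleton to skeletonV)
    private
      module V = Skeleton skeletonV
      ψ-im = W-ψ-image 0

    S-T-branching : ∀ k → Branching (W 0) (S N d (suc k)) (T N d (suc k))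
    S-T-branching k = subst₂ (Branching (W 0)) (sym (S-ψ (suc k))) (sym (T-ψ k)) (ψ-branching ψ-im (Ŝ-T̂-branching k))

    W-head : W 0 0 ≡ 𝟎
    W-head with ψ-im (X-head 0 ∷ [])
    ... | x ∷ _ = x

    prefixes-special : ∀ {w} → w ≼ W 0 → LeftSpecial (W 0) w
    prefixes-special p = let z , z≼ , _ , w⊑ = image-cover ψ-nonempty ψ-im p in
      LeftSpecial-⊑ w⊑ (ψ-LeftSpecial ψ-im (V.prefix-special z≼))

    T-special : ∀ k → LeftSpecial (W 0) (T N d k)
    T-special zero    = subst (LeftSpecial (W 0)) (trans (map-replicate swap M 𝟎) (sym T-zero))
      (LeftSpecial-unswap (η-replicate-LeftSpecial (ψ-image-swap ψ-im) (X-𝟎𝟏 0)))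
    T-special (suc k) = subst (LeftSpecial (W 0)) (sym (T-ψ k)) (ψ-LeftSpecial ψ-im (V.T-special (suc k)))

    special : ∀ {w} → LeftSpecial (W 0) w → w ≼ W 0 ⊎ ∃[ k ] w ⊑ T N d k
    special {w} ls with η-LeftSpecial⁻ (ψ-image-swap ψ-im) (X-no-𝟏𝟏 0) (LeftSpecial-swap ls)
    ... | inj₁ w⊑ = inj₂ (0 , subst₂ _⊑_ (map-swap-involutive w) (trans (map-replicate swap M 𝟎) (sym T-zero)) (map-⊑ swap w⊑))
    ... | inj₂ (z , ls′ , w⊑ , _) = from-V (V.special ls′)
      where
      w⊑ψz : w ⊑ concatMap ψ z
      w⊑ψz = subst₂ _⊑_ (map-swap-involutive w) (sym (concatMap-ψ z)) (map-⊑ swap w⊑)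
      from-V : z ≼ V 0 ⊎ (∃[ k ] z ⊑ T̂ N d k) → w ≼ W 0 ⊎ ∃[ k ] w ⊑ T N d k
      from-V (inj₁ p)           = inj₁ (⊑-≼-trans w⊑ψz (ψ-im p))
      from-V (inj₂ (zero , [])) = inj₁ (⊑-≼-trans w⊑ψz [])
      from-V (inj₂ (suc k , p)) = inj₂ (suc k , ⊑-trans w⊑ψz (subst (concatMap ψ z ⊑_) (sym (T-ψ k)) (concatMap-⊑ ψ p)))

    ∣Σ∣-mono : ∀ k → ∣Σ∣ k ≤ ∣Σ∣ (suc k)
    ∣Σ∣-mono zero    = ≤-refl
    ∣Σ∣-mono (suc k) = subst (∣Σ∣ (suc k) ≤_) (sym (∣Σ∣-suc-suc k))
      (≤-trans (≤-trans (≤-reflexive (sym (*-identityˡ (∣Σ∣ (suc k))))) (*-monoˡ-≤ (∣Σ∣ (suc k)) (1≤d k))) (m≤m+n _ _))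

    1≤∣Σ∣ : ∀ k → 1 ≤ ∣Σ∣ k
    1≤∣Σ∣ zero    = ≤-refl
    1≤∣Σ∣ (suc k) = ≤-trans (1≤∣Σ∣ k) (∣Σ∣-mono k)

    T<S : ∀ k → t N d k < s N d (suc k)
    T<S k = subst₂ _<_ (sym (t-formula k)) (sym (s-suc k)) (+-monoˡ-< (s N d k) (begin-strict
      M * ∣Σ∣ k                ≤⟨ *-monoʳ-≤ M (∣Σ∣-mono k) ⟩
      M * ∣Σ∣ (suc k)          <⟨ +-monoˡ-< (M * ∣Σ∣ (suc k)) (1≤∣Σ∣ (suc k)) ⟩
      N * ∣Σ∣ (suc k)          ≤⟨ *-monoˡ-≤ (∣Σ∣ (suc k)) (M<d k) ⟩
      d (suc k) * ∣Σ∣ (suc k)  ∎))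
      where open ≤-Reasoning

    T₀-beyond : ∀ {w} → w ⊑ T N d 0 → 0 < length w → ¬ w ≼ W 0
    T₀-beyond {a ∷ w} w⊑ _ (x ∷ _) = 𝟎≢𝟏 (trans (sym x) W-head) (all-𝟏 M (subst (a ∷ w ⊑_) T-zero w⊑))
      where
      all-𝟏 : ∀ n → a ∷ w ⊑ replicate n 𝟏 → a ≡ 𝟏
      all-𝟏 (suc n) (e ∷ _) = e

    skeleton : Skeleton (W 0) (S N d) (T N d)
    skeleton = record
      { prefix-special = prefixes-special
      ; T-special      = T-special
      ; special        = special
      ; S-zero         = refl
      ; S≼             = λ { zero → [] ; (suc k) → branching-≼ (S-T-branching k) }
      ; S⊑T            = λ { zero → [] ; (suc k) → branching-⊑ (S-T-branching k) }
      ; T<S            = T<S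
      ; beyond         = λ { zero → T₀-beyond ; (suc k) → branching-beyond (S-T-branching k) }
      }

-- Counting factors

swap-≢ : ∀ a → swap a ≢ a
swap-≢ 𝟎 ()
swap-≢ 𝟏 ()

≢⇒≡swap : ∀ {a b} → a ≢ b → a ≡ swap b
≢⇒≡swap {𝟎} {𝟎} a≢b = contradiction refl a≢b
≢⇒≡swap {𝟎} {𝟏} a≢b = refl
≢⇒≡swap {𝟏} {𝟎} a≢b = refl
≢⇒≡swap {𝟏} {𝟏} a≢b = contradiction refl a≢b

LeftSpecial-intro : ∀ {u w a b} → a ≢ b → Factor u (a ∷ w) → Factor u (b ∷ w) → LeftSpecial u w
LeftSpecial-intro {u} {w} {a} {b} a≢b fa fb c with c ≟ᶠ a
... | yes refl = fa
... | no  c≢a  = subst (λ x → Factor u (x ∷ w)) (trans (≢⇒≡swap (a≢b ∘ sym)) (sym (≢⇒≡swap c≢a))) fb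

Factor-predecessor : ∀ {u w} → Factor u w → w ≼ u ⊎ ∃[ a ] Factor u (a ∷ w)
Factor-predecessor (v , here , p) = inj₁ p
Factor-predecessor {u} (v , skip u⇝v , p) with Factor-predecessor (v , u⇝v , p)
... | inj₁ q                    = inj₂ (u 0 , u , here , refl ∷ q)
... | inj₂ (a , v′ , u⇝v′ , q) = inj₂ (a , v′ , skip u⇝v′ , q)

⇝-shift : ∀ u i → u ⇝ (λ j → u (i + j))
⇝-shift u zero    = here
⇝-shift u (suc i) = skip (⇝-shift (tail u) i)

Factor⇒factorAt : ∀ {u w} → Factor u w → ∃[ i ] w ≡ factorAt u i (length w)
Factor⇒factorAt (v , here , p)     = 0 , ≼⇒≡applyUpTo p
Factor⇒factorAt (v , skip u⇝v , p) = let i , eq = Factor⇒factorAt (v , u⇝v , p) in suc i , eq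

factorAt⇒Factor : ∀ u i n → Factor u (factorAt u i n)
factorAt⇒Factor u i n = _ , ⇝-shift u i , applyUpTo-≼ _ n

module Counting {u : Seq} {S T : ℕ → Word} (sk : Skeleton u S T) where
  open Skeleton sk

  private
    ∣S∣ ∣T∣ : ℕ → ℕ
    ∣S∣ k = length (S k)
    ∣T∣ k = length (T k)

  s≤t : ∀ k → ∣S∣ k ≤ ∣T∣ k
  s≤t k = Prefix.length-mono (S⊑T k)

  t-mono : ∀ {j k} → j ≤ k → ∣T∣ j ≤ ∣T∣ k
  t-mono {j} {k} j≤k with m≤n⇒m<n∨m≡n j≤k
  ... | inj₂ refl = ≤-refl
  t-mono {j} {suc k} _ | inj₁ (s≤s j≤k) = ≤-trans (t-mono j≤k) (≤-trans (<⇒≤ (T<S k)) (s≤t (suc k)))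

  t<s : ∀ {j k} → j < k → ∣T∣ j < ∣S∣ k
  t<s {j} {suc k} (s≤s j≤k) = ≤-<-trans (t-mono j≤k) (T<S k)

  -- `double` and `single` tell the number of left special words of length `n`; length 0 lies in no
  -- interval, as the first one starts after s_0 = 0.
  data Position (n : ℕ) : Set where
    origin : n ≡ 0 → Position n
    double : ∀ k → ∣S∣ k < n → n ≤ ∣T∣ k → Position n
    single : ∀ k → ∣T∣ k < n → n ≤ ∣S∣ (suc k) → Position n

  next : ∀ {n} k → ∣S∣ k < suc n → n ≤ ∣T∣ k → Position (suc n)
  next {n} k s<n n≤t with suc n ≤? ∣T∣ k
  ... | yes n<t = double k s<n n<t
  ... | no  n≮t = single k (≰⇒> n≮t) (≤-trans (s≤s n≤t) (T<S k))

  position : ∀ n → Position n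
  position zero = origin refl
  position (suc n) with position n
  ... | origin refl      = next 0 (subst (_< 1) (sym S-zero) (s≤s z≤n)) z≤n
  ... | double k s<n n≤t = next k (m<n⇒m<1+n s<n) n≤t
  ... | single k t<n n≤s with suc n ≤? ∣S∣ (suc k)
  ...   | yes n<s = single k (m<n⇒m<1+n t<n) n<s
  ...   | no  n≮s = next (suc k) (≰⇒> n≮s) (≤-trans n≤s (s≤t (suc k)))

  double-unique : ∀ {j k n} → ∣S∣ j < n → n ≤ ∣T∣ j → ∣S∣ k < n → n ≤ ∣T∣ k → j ≡ k
  double-unique {j} {k} s<n n≤t s<n′ n≤t′ = ≤-antisym
    (≮⇒≥ λ k<j → <-irrefl refl (≤-<-trans n≤t′ (<-trans (t<s k<j) s<n)))
    (≮⇒≥ λ j<k → <-irrefl refl (≤-<-trans n≤t (<-trans (t<s j<k) s<n′)))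

  double-single : ∀ {j k n} → ∣S∣ j < n → n ≤ ∣T∣ j → ∣T∣ k < n → ¬ n ≤ ∣S∣ (suc k)
  double-single {j} {k} s<n n≤t t<n n≤s = <-irrefl refl (≤-<-trans n≤s (≤-<-trans
    (≮⇒≥ λ j<sk → <-irrefl refl (≤-<-trans (≤-trans n≤t (t-mono (≤-pred (j≤k′ j<sk)))) t<n)) s<n))
    where
    j≤k′ : ∣S∣ j < ∣S∣ (suc k) → suc j ≤ suc k
    j≤k′ h = ≮⇒≥ λ k<j → <-irrefl refl (<-≤-trans h (s-mono k<j))
      where
      s-mono : suc k < suc j → ∣S∣ (suc k) ≤ ∣S∣ j
      s-mono (s≤s k<j) with m≤n⇒m<n∨m≡n k<j
      ... | inj₁ lt   = <⇒≤ (≤-<-trans (s≤t (suc k)) (t<s lt))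
      ... | inj₂ refl = ≤-refl

  prefix : ℕ → Word
  prefix = applyUpTo u

  specials-at : ∀ {n} → Position n → List Word
  specials-at {n} (origin _)     = [ prefix n ]
  specials-at {n} (double k _ _) = prefix n ∷ take n (T k) ∷ []
  specials-at {n} (single k _ _) = [ prefix n ]

  specials : ℕ → List Word
  specials n = specials-at (position n)

  specials-unique : ∀ {n} (q : Position n) → Unique (specials-at q)
  specials-unique     (origin _)       = [] ∷ []
  specials-unique {n} (double k s<n n≤t) = (distinct ∷ []) ∷ [] ∷ []
    where
    distinct : prefix n ≢ take n (T k)
    distinct eq = beyond k (take-⊑ n (T k))
      (subst (∣S∣ k <_) (sym (trans (length-take n (T k)) (m≤n⇒m⊓n≡m n≤t))) s<n)
      (subst (_≼ u) eq (applyUpTo-≼ u n))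
  specials-unique     (single k _ _)   = [] ∷ []

  prefix-sound : ∀ {n w} → w ≡ prefix n → length w ≡ n × LeftSpecial u w
  prefix-sound {n} refl = length-applyUpTo u n , prefix-special (applyUpTo-≼ u n)

  specials-sound : ∀ {n} (q : Position n) {w} → w ∈ specials-at q → length w ≡ n × LeftSpecial u w
  specials-sound     (origin _)         (here eq)           = prefix-sound eq
  specials-sound     (double k s<n n≤t) (here eq)           = prefix-sound eq
  specials-sound {n} (double k s<n n≤t) (there (here refl)) =
    trans (length-take n (T k)) (m≤n⇒m⊓n≡m n≤t) , LeftSpecial-⊑ (take-⊑ n (T k)) (T-special k)
  specials-sound     (single k _ _)     (here eq)           = prefix-sound eq

  prefix-∈-specials : ∀ {w} (q : Position (length w)) → w ≼ u → w ∈ specials-at q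
  prefix-∈-specials (origin _)     p = here (≼⇒≡applyUpTo p)
  prefix-∈-specials (double _ _ _) p = here (≼⇒≡applyUpTo p)
  prefix-∈-specials (single _ _ _) p = here (≼⇒≡applyUpTo p)

  specials-complete : ∀ {w} (q : Position (length w)) → LeftSpecial u w → w ∈ specials-at q
  specials-complete {w} q ls with special ls
  ... | inj₁ p = prefix-∈-specials q p
  ... | inj₂ (k , w⊑T) with length w ≤? ∣S∣ k
  ...   | yes w≤s = prefix-∈-specials q (⊑-≼-trans (⊑-comparable w⊑T (S⊑T k) w≤s) (S≼ k))
  ...   | no  w≰s with q
  ...     | origin eq = contradiction (subst (_≤ ∣S∣ k) (sym eq) z≤n) w≰s
  ...     | single j t<w w≤s = contradiction w≤s (double-single (≰⇒> w≰s) (Prefix.length-mono w⊑T) t<w)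
  ...     | double j s<w w≤t with refl ← double-unique (≰⇒> w≰s) (Prefix.length-mono w⊑T) s<w w≤t =
    there (here (⊑⇒≡take w⊑T))

  special? : ∀ w → Dec (LeftSpecial u w)
  special? w = map′ (proj₂ ∘ specials-sound (position (length w))) (specials-complete (position (length w)))
    (w ∈? specials (length w))

  -- An occurrence at position 0 has no left neighbour, but then `w` is a prefix and hence left
  -- special.
  extend : ∀ {w} → Factor u w → ∃[ a ] Factor u (a ∷ w)
  extend f with Factor-predecessor f
  ... | inj₁ p = 𝟎 , prefix-special p 𝟎
  ... | inj₂ r = r

  -- A factor `w` has some left extension by `b`; an extension by another letter would make `w` left
  -- special, which the explicit list decides.
  factor? : ∀ w → Dec (Factor u w)
  factor? []      = yes (u , here , [])
  factor? (a ∷ w) with factor? w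
  ... | no ¬f = no (¬f ∘ Factor-++ [ a ])
  ... | yes f with extend f
  ...   | b , fb with a ≟ᶠ b
  ...     | yes refl = yes fb
  ...     | no  a≢b with special? w
  ...       | yes ls = yes (ls a)
  ...       | no ¬ls = no λ fa → ¬ls (LeftSpecial-intro a≢b fa fb)

  pred-letter : Word → Letter
  pred-letter w with factor? (𝟎 ∷ w)
  ... | yes _ = 𝟎
  ... | no  _ = 𝟏

  pred-letter-factor : ∀ {w} → Factor u w → Factor u (pred-letter w ∷ w)
  pred-letter-factor {w} f with factor? (𝟎 ∷ w)
  ... | yes f₀ = f₀
  ... | no ¬f₀ with extend f
  ...   | 𝟎 , f₀ = contradiction f₀ ¬f₀
  ...   | 𝟏 , f₁ = f₁

  -- Each factor of length n contributes one chosen left extension, and the left special ones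
  -- contribute the other letter as well; the lengths of the two parts give the increment of the
  -- complexity.
  factors : ℕ → List Word
  factors zero    = [ [] ]
  factors (suc n) = map (λ w → pred-letter w ∷ w) (factors n) ++ map (λ w → swap (pred-letter w) ∷ w) (specials n)

  factors-unique : ∀ n → Unique (factors n)
  factors-unique zero    = [] ∷ []
  factors-unique (suc n) = Unique.++⁺ (Unique.map⁺ ∷-injectiveʳ (factors-unique n))
    (Unique.map⁺ ∷-injectiveʳ (specials-unique (position n))) disjoint
    where
    disjoint : ∀ {w} → ¬ (w ∈ map (λ w → pred-letter w ∷ w) (factors n) × w ∈ map (λ w → swap (pred-letter w) ∷ w) (specials n))
    disjoint (p , q) with ∈-map⁻ _ p | ∈-map⁻ _ q
    ... | v , _ , refl | v′ , _ , eq with refl ← ∷-injectiveʳ eq = swap-≢ _ (sym (∷-injectiveˡ eq))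

  factors-sound : ∀ n {w} → w ∈ factors n → length w ≡ n × Factor u w
  factors-sound zero    (here refl) = refl , u , here , []
  factors-sound (suc n) w∈ with ∈-++⁻ (map (λ w → pred-letter w ∷ w) (factors n)) w∈
  ... | inj₁ p with v , v∈ , refl ← ∈-map⁻ _ p = let l , f = factors-sound n v∈ in cong suc l , pred-letter-factor f
  ... | inj₂ p with v , v∈ , refl ← ∈-map⁻ _ p = let l , ls = specials-sound (position n) v∈ in cong suc l , ls _

  factors-complete : ∀ w → Factor u w → w ∈ factors (length w)
  factors-complete []      _ = here refl
  factors-complete (a ∷ w) f with a ≟ᶠ pred-letter w
  ... | yes a≡ = subst (λ x → x ∷ w ∈ factors (suc (length w))) (sym a≡)
    (∈-++⁺ˡ (∈-map⁺ (λ w → pred-letter w ∷ w) (factors-complete w (Factor-++ [ a ] f))))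
  ... | no  a≢ = subst (λ x → x ∷ w ∈ factors (suc (length w))) (sym (≢⇒≡swap a≢))
    (∈-++⁺ʳ (map (λ w → pred-letter w ∷ w) (factors (length w))) (∈-map⁺ (λ w → swap (pred-letter w) ∷ w)
      (specials-complete (position (length w)) (LeftSpecial-intro a≢ f (pred-letter-factor (Factor-++ [ a ] f))))))

  complexity : ℕ → ℕ
  complexity n = length (factors n)

  isComplexity : IsComplexity u complexity
  isComplexity n = factors n , factors-unique n , refl , λ w → mk⇔
    (λ w∈ → let l , f = factors-sound n w∈ ; i , eq = Factor⇒factorAt f in
            i , trans eq (cong (factorAt u i) l))
    (λ { (i , refl) → subst (λ m → factorAt u i n ∈ factors m) (length-applyUpTo _ n)
            (factors-complete _ (factorAt⇒Factor u i n)) })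

  complexity-suc : ∀ n → complexity (suc n) ≡ complexity n + length (specials n)
  complexity-suc n = trans (length-++ (map (λ w → pred-letter w ∷ w) (factors n)))
    (cong₂ _+_ (length-map _ (factors n)) (length-map _ (specials n)))

  complexity-double : ∀ k {n} → ∣S∣ k < n → n ≤ ∣T∣ k → complexity (suc n) ≡ 2 + complexity n
  complexity-double k {n} s<n n≤t = trans (complexity-suc n)
    (trans (cong (complexity n +_) (two (position n))) (+-comm _ 2))
    where
    two : (q : Position n) → length (specials-at q) ≡ 2
    two (origin eq)        = contradiction (subst (∣S∣ k <_) eq s<n) n≮0
    two (double _ _ _)     = refl
    two (single j t<n n≤s) = contradiction n≤s (double-single s<n n≤t t<n)

  complexity-single : ∀ k {n} → ∣T∣ k < n → n ≤ ∣S∣ (suc k) → complexity (suc n) ≡ suc (complexity n)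
  complexity-single k {n} t<n n≤s = trans (complexity-suc n)
    (trans (cong (complexity n +_) (one (position n))) (+-comm _ 1))
    where
    one : (q : Position n) → length (specials-at q) ≡ 1
    one (origin _)          = refl
    one (double j s<n n≤t)  = contradiction n≤s (double-single s<n n≤t t<n)
    one (single _ _ _)      = refl

  complexity-≤ : ∀ n → 1 ≤ n → complexity n ≤ 2 * n
  complexity-≤ (suc zero)    _ = ≤-refl
  complexity-≤ (suc (suc n)) _ = begin
    complexity (suc (suc n))                            ≡⟨ complexity-suc (suc n) ⟩
    complexity (suc n) + length (specials (suc n))      ≤⟨ +-mono-≤ (complexity-≤ (suc n) (s≤s z≤n)) (at-most-two (position (suc n))) ⟩
    2 * suc n + 2                                       ≡⟨ +-comm (2 * suc n) 2 ⟩
    2 + 2 * suc n                                       ≡⟨ *-suc 2 (suc n) ⟨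
    2 * suc (suc n)                                     ∎
    where
    open ≤-Reasoning
    at-most-two : ∀ {n} (q : Position n) → length (specials-at q) ≤ 2
    at-most-two (origin _)     = s≤s z≤n
    at-most-two (double _ _ _) = ≤-refl
    at-most-two (single _ _ _) = s≤s z≤n

  -- `G k` is the total length of the double intervals with index below `k`; `G-suc` says G(k+1) -
  -- G(k) = t_k - s_k without subtraction.
  module Formulas (G : ℕ → ℕ) (G-zero : G 0 ≡ 0) (G-suc : ∀ k → ∣T∣ k + G k ≡ ∣S∣ k + G (suc k)) where

    private
      p = complexity

      double-base : ∀ x g → suc (suc x) + g + x ≡ 2 * suc x + g
      double-base = solve-∀

      double-step : ∀ {x s n g} → x + s ≡ 2 * n + g → 2 + x + s ≡ 2 * suc n + g
      double-step {n = n} {g} eq = trans (cong (2 +_) eq) (rearrange n g)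
        where
        rearrange : ∀ n g → 2 + (2 * n + g) ≡ 2 * suc n + g
        rearrange = solve-∀

      single-base : ∀ {x s t g g′} → x + s ≡ 2 * suc t + g → t + g ≡ s + g′ → x ≡ suc t + 1 + g′
      single-base {x} {s} {t} {g} {g′} e e′ = +-cancelʳ-≡ s x (suc t + 1 + g′) (begin
        x + s                  ≡⟨ e ⟩
        2 * suc t + g          ≡⟨ rearrange₁ t g ⟩
        2 + t + (t + g)        ≡⟨ cong (2 + t +_) e′ ⟩
        2 + t + (s + g′)       ≡⟨ rearrange₂ t s g′ ⟩
        suc t + 1 + g′ + s     ∎)
        where
        open ≡-Reasoning
        rearrange₁ : ∀ t g → 2 * suc t + g ≡ 2 + t + (t + g)
        rearrange₁ = solve-∀
        rearrange₂ : ∀ t s g → 2 + t + (s + g) ≡ suc t + 1 + g + s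
        rearrange₂ = solve-∀

    mutual
      -- The increment at n determines p(n + 1), so each formula still holds one step past its
      -- interval, and that value starts the next interval. This couples the three statements.
      after-s : ∀ k → p (suc (∣S∣ k)) ≡ suc (suc (∣S∣ k)) + G k
      after-s zero    rewrite S-zero | G-zero = refl
      after-s (suc k) = trans (single′ k (m<n⇒m<1+n (T<S k)) ≤-refl) (cong (λ x → suc x + G (suc k)) (+-comm (∣S∣ (suc k)) 1))

      double′ : ∀ k {n} → ∣S∣ k < n → n ≤ suc (∣T∣ k) → p n + ∣S∣ k ≡ 2 * n + G k
      double′ k {suc n} (s≤s s≤n) (s≤s n≤t) with m≤n⇒m<n∨m≡n s≤n
      ... | inj₂ refl = trans (cong (_+ ∣S∣ k) (after-s k)) (double-base (∣S∣ k) (G k))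
      ... | inj₁ s<n  = trans (cong (_+ ∣S∣ k) (complexity-double k s<n n≤t))
        (double-step {p n} {∣S∣ k} {n} {G k} (double′ k s<n (m≤n⇒m≤1+n n≤t)))

      single′ : ∀ k {n} → ∣T∣ k < n → n ≤ suc (∣S∣ (suc k)) → p n ≡ n + 1 + G (suc k)
      single′ k {suc n} (s≤s t≤n) (s≤s n≤s) with m≤n⇒m<n∨m≡n t≤n
      ... | inj₂ refl = single-base {p (suc (∣T∣ k))} {∣S∣ k} {∣T∣ k} {G k} (double′ k (s≤s (s≤t k)) ≤-refl) (G-suc k)
      ... | inj₁ t<n  = trans (complexity-single k t<n n≤s) (cong suc (single′ k t<n (m≤n⇒m≤1+n n≤s)))

    -- The constant comes from p(s_k + 1) = s_k + 2 + G(k): since 2(s_k + 1) - s_k is already s_k +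
    -- 2, only G(k) is added, and interval k itself is not yet counted in it.
    double-formula : ∀ k n → ∣S∣ k < n → n ≤ ∣T∣ k → p n ≡ 2 * n + G k ∸ ∣S∣ k
    double-formula k n s<n n≤t = trans (sym (m+n∸n≡m (p n) (∣S∣ k))) (cong (_∸ ∣S∣ k) (double′ k s<n (m≤n⇒m≤1+n n≤t)))

    single-formula : ∀ k n → ∣T∣ k < n → n ≤ ∣S∣ (suc k) → p n ≡ n + 1 + G (suc k)
    single-formula k n t<n n≤s = single′ k t<n (m≤n⇒m≤1+n n≤s)

-- The closed formulas

sum-applyUpTo-suc : ∀ f n → sum (applyUpTo f (suc n)) ≡ sum (applyUpTo f n) + f n
sum-applyUpTo-suc f n = begin
  sum (applyUpTo f (suc n))        ≡⟨ cong sum (applyUpTo-∷ʳ f n) ⟨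
  sum (applyUpTo f n ++ [ f n ])   ≡⟨ sum-++ (applyUpTo f n) [ f n ] ⟩
  sum (applyUpTo f n) + (f n + 0)  ≡⟨ cong (sum (applyUpTo f n) +_) (+-identityʳ (f n)) ⟩
  sum (applyUpTo f n) + f n        ∎
  where open ≡-Reasoning

-- A double interval has length t_k - s_k = (N - 1)|Σ_k|, so passing it adds exactly one summand to
-- the sum.
gap-sum : ∀ {t s} M x G → t ≡ M * x + s → t + G * M ≡ s + (G + x) * M
gap-sum {s = s} M x G refl = rearrange M x s G
  where
  rearrange : ∀ m x s g → m * x + s + g * m ≡ s + (g + x) * m
  rearrange = solve-∀

-- Puts `ω` itself in place of `W 1`, to which it is only pointwise equal, and shifts the index so
-- that the chain starts at 0.
directed-chain : ∀ τ {ω} → IsDirectedBy τ ω →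
  ∃[ X ] (∀ k → IsImage (toList ∘ τ (suc k)) (X (suc k)) (X k)) × X 0 ≡ ω
directed-chain τ {ω} (W , W₁≗ω , W-image) = X , image , refl
  where
  X : ℕ → Seq
  X zero    = ω
  X (suc k) = W (suc (suc k))
  image : ∀ k → IsImage (toList ∘ τ (suc k)) (X (suc k)) (X k)
  image zero    p = ≼-resp-≗ (λ i → trans (sym (W-image 1 (s≤s z≤n) i)) (W₁≗ω i)) (applyˢ-image (τ 1) (W 2) p)
  image (suc k) p = ≼-resp-≗ (λ i → sym (W-image (suc (suc k)) (s≤s z≤n) i)) (applyˢ-image (τ (suc (suc k))) (W (suc (suc (suc k)))) p)

module _ (M : ℕ) (1≤M : 1 ≤ M) (d : ℕ → ℕ) (M<d : ∀ k → M < d (suc k)) where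

  private
    N = suc M

  module PrimalComplexity {ω : Seq} (directed : IsNCFSequence N d ω) where

    skeleton : Skeleton ω (S N d) (T N d)
    skeleton with _ , im , refl ← directed-chain (σ N d) directed = Primal.PrimalChain.skeleton M 1≤M d M<d _ im

    open Primal.Words M d

    G : ℕ → ℕ
    G k = sumPQ N d k * M

    G-suc : ∀ k → t N d k + G k ≡ s N d k + G (suc k)
    G-suc k = trans
      (gap-sum M (num N d k + den N d k) (sumPQ N d k)
        (trans (t-formula k) (cong (λ x → M * x + s N d k) (∣Σ∣-formula k))))
      (cong (λ x → s N d k + x * M) (sym (sum-applyUpTo-suc (λ i → num N d i + den N d i) k)))

    open Counting skeleton public
    open Formulas G refl G-suc public

  module DualComplexity {ω̂ : Seq} (directed : IsDualNCFSequence N d ω̂) where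
    open Dual M

    chain : ∃[ X ] (∀ k → IsImage (χ (d (suc k))) (X (suc k)) (X k)) × X 0 ≡ ω̂
    chain = let X , im , eq = directed-chain (σ̂ N d) directed in
      X , (λ k → image-cong (λ { 𝟎 → χˢ≗χ (d (suc k)) 𝟎 ; 𝟏 → refl }) (im k)) , eq

    private
      module Chain = DualChain M 1≤M d M<d (proj₁ chain) (proj₁ (proj₂ chain))

    skeleton : Skeleton ω̂ (Ŝ N d) (T̂ N d)
    skeleton = subst (λ u → Skeleton u (Ŝ N d) (T̂ N d)) (proj₂ (proj₂ chain)) Chain.skeleton

    open Counting skeleton public

    -- The first gap is empty: both words with index 0 are empty.
    G : ℕ → ℕ
    G zero    = 0
    G (suc k) = sumP/NQ N d k * M

    G-suc : ∀ k → t̂ N d k + G k ≡ ŝ N d k + G (suc k)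
    G-suc zero    = refl
    G-suc (suc k) = trans (gap-sum M (num N d (suc k) / N + den N d (suc k)) (sumP/NQ N d k)
        (trans (Chain.t̂-suc k) (cong (λ x → M * x + ŝ N d (suc k)) (Chain.∣Σ̂∣-formula k))))
      (cong (λ x → ŝ N d (suc k) + x * M) (sym (sum-applyUpTo-suc (λ j → num N d (suc j) / N + den N d (suc j)) k)))

    open Formulas G refl G-suc public

theorem5p9 : (N : ℕ) .{{_ : NonZero N}} → 2 ≤ N →
    (x : ℝ) → x ∈[0,1] → Irrational x →
    (d : ℕ → ℕ) → IsNCFDigits N x d →
    (ω ω̂ : Seq) → IsNCFSequence N d ω → IsDualNCFSequence N d ω̂ →
    Σ[ pω ∈ (ℕ → ℕ) ] Σ[ pω̂ ∈ (ℕ → ℕ) ]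
    IsComplexity ω pω × IsComplexity ω̂ pω̂
    × (∀ n → 1 ≤ n → pω n ≤ 2 * n)
    × (∀ n → 1 ≤ n → pω̂ n ≤ 2 * n)
    × (pω 0 ≡ 1)
    × (∀ n → 1 ≤ n → n ≤ N ∸ 1 → pω n ≡ 2 * n)
    × (∀ k n → t N d k < n → n ≤ s N d (k + 1) →
    pω n ≡ n + 1 + sumPQ N d (k + 1) * (N ∸ 1))
    × (∀ k n → 1 ≤ k → s N d k < n → n ≤ t N d k →
    pω n ≡ 2 * n + sumPQ N d k * (N ∸ 1) ∸ s N d k)
    × (pω̂ 0 ≡ 1)
    × (∀ k n → 1 ≤ k → t̂ N d (k ∸ 1) < n → n ≤ ŝ N d k →
    pω̂ n ≡ n + 1 + sumP/NQ N d (k ∸ 1) * (N ∸ 1))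
    × (∀ k n → 1 ≤ k → ŝ N d k < n → n ≤ t̂ N d k →
    pω̂ n ≡ 2 * n + sumP/NQ N d (k ∸ 1) * (N ∸ 1) ∸ ŝ N d k)
theorem5p9 (suc M) (s≤s 1≤M) x x∈ _ d digits ω ω̂ ω-directed ω̂-directed =
    P.complexity , D.complexity , P.isComplexity , D.isComplexity , P.complexity-≤ , D.complexity-≤ , refl
  -- The range 1 ≤ n ≤ N - 1 is the interval (s_0, t_0], where both s_0 and `G 0` vanish.
  , (λ n 1≤n n≤M → trans (P.double-formula 0 n 1≤n (subst (n ≤_) (sym t₀≡M) n≤M)) (+-identityʳ (2 * n)))
  , (λ k → subst (λ j → ∀ n → t N d k < n → n ≤ s N d j → P.complexity n ≡ n + 1 + sumPQ N d j * M)
                 (+-comm 1 k) (P.single-formula k))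
  , (λ k n _ → P.double-formula k n)
  , refl
  , (λ { (suc k) n _ → D.single-formula k n })
  , (λ { (suc k) n _ → D.double-formula (suc k) n })
  where
  N = suc M
  module P = PrimalComplexity M 1≤M d (digit-≥ x x∈ digits) ω-directed
  module D = DualComplexity M 1≤M d (digit-≥ x x∈ digits) ω̂-directed
  t₀≡M : t N d 0 ≡ M
  t₀≡M = trans (Primal.Words.t-formula M d 0) (trans (+-identityʳ (M * 1)) (*-identityʳ M))
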